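{- For any $k\ge 32$ and any constant $\varepsilon$ with $1/k\le\varepsilon\le 1/32$ such that $\varepsilon k$ is a power of $2$, every deterministic online algorithm for the online graph partitioning problem (with $\ell$ servers of capacity $k$, online capacity $(1+\varepsilon)k$) has competitive ratio $\Omega(\ell\log k)$.
   Context: Online graph partitioning problem: There is a vertex set $V$ with $|V|=\ell\cdot k$. Initially each vertex is assigned to one of $\ell$ servers so that every server holds exactly $k$ vertices, and the graph $G=(V,E)$ has $E=\emptyset$. Edges of $G$ are then revealed one by one in an online fashion. The request sequence is guaranteed to be such that at all times there exists an assignment of vertices to servers in which each server holds at most $k$ vertices and every connected component of the current graph lies entirely on one server. After each edge insertion, an online algorithm must (possibly) move vertices between servers so that every connected component of the revealed graph lies entirely on a single server (cc-condition), while each server holds at most $(1+\varepsilon)k$ vertices. Each vertex move costs $1/k$. The optimal offline algorithm $\mathrm{OPT}$ knows the whole sequence in advance and must keep at most $k$ vertices per server; its cost is the minimum total cost of moves needed. The (strict) competitive ratio of a deterministic online algorithm $\mathrm{ONL}$ is the supremum over adversarially chosen request sequences of $\mathrm{cost}(\mathrm{ONL})/\mathrm{cost}(\mathrm{OPT})$. -}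

module Defs where

open import Data.Nat using (ℕ; zero; suc; _+_; _*_; _≤_; _<_)
open import Data.Nat.Logarithm using (⌊log₂_⌋)
open import Data.Fin using (Fin; _≟_)
open import Data.List using (List; []; _∷_; length; filter; take; allFin)
open import Data.List.Membership.Propositional using (_∈_)
open import Data.Product using (Σ; _×_; _,_)
open import Data.Sum using (_⊎_)
open import Relation.Nullary using (¬_; ¬?)
open import Relation.Binary.PropositionalEquality using (_≡_)

-- Online graph partitioning with ℓ servers, vertex set V = Fin (ℓ * k).
-- Move costs are counted in number of vertex moves (each costs 1/k);
-- the factor 1/k cancels in the competitive ratio.

Vertex : ℕ → ℕ → Set
Vertex ℓ k = Fin (ℓ * k)

Server : ℕ → Set
Server ℓ = Fin ℓ

Edge : ℕ → ℕ → Set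
Edge ℓ k = Vertex ℓ k × Vertex ℓ k

Assignment : ℕ → ℕ → Set
Assignment ℓ k = Vertex ℓ k → Server ℓ

load : ∀ {ℓ k} → Assignment ℓ k → Server ℓ → ℕ
load {ℓ} {k} a s = length (filter (λ v → a v ≟ s) (allFin (ℓ * k)))

LoadBounded : ∀ {ℓ k} → ℕ → Assignment ℓ k → Set
LoadBounded {ℓ} cap a = (s : Server ℓ) → load a s ≤ cap

Balanced : ∀ {ℓ k} → Assignment ℓ k → Set
Balanced {ℓ} {k} a = (s : Server ℓ) → load a s ≡ k

dist : ∀ {ℓ k} → Assignment ℓ k → Assignment ℓ k → ℕ
dist {ℓ} {k} a b = length (filter (λ v → ¬? (a v ≟ b v)) (allFin (ℓ * k)))

data Connected {ℓ k} (E : List (Edge ℓ k)) (u : Vertex ℓ k) : Vertex ℓ k → Set where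
  here : Connected E u u
  step : ∀ {w v} → Connected {ℓ} {k} E u w → ((w , v) ∈ E ⊎ (v , w) ∈ E) → Connected E u v

CC : ∀ {ℓ k} → List (Edge ℓ k) → Assignment ℓ k → Set
CC {ℓ} {k} E a = (u v : Vertex ℓ k) → Connected {ℓ} {k} E u v → a u ≡ a v

Admissible : ∀ {ℓ k} → ℕ → List (Edge ℓ k) → Assignment ℓ k → Set
Admissible cap E a = CC E a × LoadBounded cap a

-- valid request sequence: there is an assignment with loads ≤ k satisfying
-- the cc-condition (for the final graph; since the graph only grows, this
-- implies the same for every prefix)
ValidSeq : ∀ {ℓ k} → List (Edge ℓ k) → Set
ValidSeq {ℓ} {k} σ = Σ (Assignment ℓ k) λ a → Admissible k σ a

-- A deterministic online algorithm: given the initial assignment and the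
-- (nonempty) list of edges revealed so far, it returns the current assignment.
OnlineAlg : ℕ → ℕ → Set
OnlineAlg ℓ k = Assignment ℓ k → List (Edge ℓ k) → Assignment ℓ k

IsOnlineAlg : ∀ ℓ k → ℕ → OnlineAlg ℓ k → Set
IsOnlineAlg ℓ k cap alg =
  (a₀ : Assignment ℓ k) → Balanced {ℓ} {k} a₀ →
  (e : Edge ℓ k) (σ : List (Edge ℓ k)) → ValidSeq {ℓ} {k} (e ∷ σ) →
  Admissible {ℓ} {k} cap (e ∷ σ) (alg a₀ (e ∷ σ))

-- cost (number of moves) of a schedule s, s i = configuration after i requests
schedCost : ∀ {ℓ k} → (ℕ → Assignment ℓ k) → ℕ → ℕ
schedCost s zero = 0
schedCost s (suc m) = schedCost s m + dist (s m) (s (suc m))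

onlSched : ∀ {ℓ k} → OnlineAlg ℓ k → Assignment ℓ k → List (Edge ℓ k) → ℕ → Assignment ℓ k
onlSched alg a₀ σ zero = a₀
onlSched alg a₀ σ (suc i) = alg a₀ (take (suc i) σ)

onlCost : ∀ {ℓ k} → OnlineAlg ℓ k → Assignment ℓ k → List (Edge ℓ k) → ℕ
onlCost alg a₀ σ = schedCost (onlSched alg a₀ σ) (length σ)

OfflineFeasible : ∀ {ℓ k} → Assignment ℓ k → List (Edge ℓ k) → (ℕ → Assignment ℓ k) → Set
OfflineFeasible {ℓ} {k} a₀ σ s =
  (s 0 ≡ a₀) × ((i : ℕ) → 1 ≤ i → i ≤ length σ → Admissible k (take i σ) (s i))

{-# OPTIONS --safe #-}
-- Put p = 2 ^ m with 8p ≤ k < 16p. Fix ℓ blocks of size k − 3p, which the adversary glues first and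
-- which are too big to share a server, and ℓ + 1 sets of size 2p. Were every set to have 7/8 of its
-- vertices on one server, two of them would share a server with a block and overload it. So at any
-- time some set is spread out. The adversary keeps each set divided into glued pieces of equal size
-- and merges the pieces of the spread-out set in pairs, taking pairs on different servers as long as
-- there are any; this costs the online algorithm p / 8. A set with two pieces left is glued
-- completely unless it is the last one, so there are (ℓ + 1) m rounds. Only the last set then consists
-- of two separate halves, and there is an offline solution moving at most 4p vertices.
module Submission where

open import Defs
open import Data.Nat using (ℕ; _+_; _*_; _^_; _≤_; _<_)
open import Data.Nat.Logarithm using (⌊log₂_⌋)
open import Data.List using (List; length)
open import Data.Product using (Σ; _×_)
open import Data.Empty using (⊥)
open import Data.Fin using (Fin; zero; suc; _≟_; combine; remQuot)
open import Data.Fin.Properties using (pigeonhole; any?; ¬∀⟶∃¬; remQuot-combine; combine-remQuot)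
import Data.Fin.Properties as Fin
open import Data.List using ([]; _∷_; _++_; [_]; map; filter; take; drop; concat; concatMap; allFin; tabulate)
open import Data.List.Properties using (length-++-≤ˡ; tabulate-cong; ++-identityʳ; map-++; ++-assoc; length-++; length-map; length-take; length-drop; length-tabulate; filter-++; filter-all; filter-none; concat-++; concat-map-[_]; take-all; take++drop≡id; concatMap-++)
open import Data.List.Membership.Propositional using (_∈_; _∉_)
open import Data.List.Membership.DecPropositional using (_∈?_)
open import Data.List.Membership.Propositional.Properties using (∈-∃++; ∈-++⁺ˡ; ∈-++⁺ʳ; ∈-++⁻; ∈-map⁺; ∈-map⁻; ∈-filter⁻; ∈-allFin; ∈-tabulate⁺; ∈-concat⁺′)
open import Data.List.Relation.Binary.Disjoint.Propositional using (Disjoint)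
open import Data.List.Relation.Binary.Permutation.Propositional using (_↭_; ↭-refl; ↭-sym; ↭-trans; ↭-reflexive; ↭-prep)
import Data.List.Relation.Binary.Permutation.Propositional as ↭
open import Data.List.Relation.Binary.Permutation.Propositional.Properties using (filter-↭; ↭-length; ∈-resp-↭; All-resp-↭; shift; shifts)
import Data.List.Relation.Binary.Permutation.Propositional.Properties as ↭ₚ
import Data.List.Relation.Binary.Permutation.Setoid.Properties as Setoid↭
open import Data.List.Relation.Binary.Subset.Propositional using (_⊆_)
open import Data.List.Relation.Unary.All using (All; []; _∷_)
import Data.List.Relation.Unary.All as All
import Data.List.Relation.Unary.All.Properties as Allₚ
open import Data.List.Relation.Unary.Any using (here; there)
open import Data.List.Relation.Unary.AllPairs using ([]; _∷_)
open import Data.List.Relation.Unary.Unique.Propositional using (Unique)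
import Data.List.Relation.Unary.Unique.Propositional.Properties as Uniqueₚ
open import Data.Nat using (zero; suc; z<s; _<?_; _∸_; _⊓_; z≤n; s≤s; _≤?_)
open import Data.Nat.Properties hiding (_≟_)
open import Data.Nat.Tactic.RingSolver using (solve-∀)
open import Data.Product using (∃; ∃₂; _,_; proj₁; proj₂; uncurry)
open import Data.Sum using (_⊎_; inj₁; inj₂)
open import Function using (_∘_; id)
open import Relation.Binary.PropositionalEquality using (_≡_; _≢_; refl; sym; trans; cong; cong₂; subst; subst₂; module ≡-Reasoning)
open import Relation.Nullary using (¬_; ¬?; yes; no; contradiction)
open import Relation.Unary using (Decidable)
open import Relation.Binary.PropositionalEquality.Properties using () renaming (setoid to ≡-setoid)
open import Data.Vec.Functional using (updateAt)
open import Data.Vec.Functional.Properties using (updateAt-updates; updateAt-minimal)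
open import Relation.Nullary.Decidable using (_×-dec_)
open import Data.Nat.ListAction using (sum)
open import Data.Nat.Logarithm using (⌊log₂⌋-mono-≤; ⌊log₂[2^n]⌋≡n)

private
  variable
    A : Set
    n ℓ : ℕ

-- Lists without repetitions, permutations and concatenations

-- Each entry of `xs` is taken out of `ys` in turn; since `xs` has no repetitions, its later entries
-- survive. This completes a set of vertices to `allFin n`, so that a count over all vertices
-- splits.
Unique-⊆⇒↭ : {xs ys : List A} → Unique xs → xs ⊆ ys → ∃ λ zs → ys ↭ xs ++ zs
Unique-⊆⇒↭ {ys = ys} [] _ = ys , ↭-refl
Unique-⊆⇒↭ {xs = x ∷ xs} (x∉xs ∷ uxs) xs⊆ys
  with us , vs , refl ← ∈-∃++ (xs⊆ys (here refl))
  = let zs , us++vs↭ = Unique-⊆⇒↭ uxs xs⊆us++vs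
    in zs , ↭-trans (shift x us vs) (↭-prep x us++vs↭)
  where
  xs⊆us++vs : xs ⊆ us ++ vs
  xs⊆us++vs v∈xs with ∈-++⁻ us (xs⊆ys (there v∈xs))
  ... | inj₁ v∈us         = ∈-++⁺ˡ v∈us
  ... | inj₂ (here refl)  = contradiction refl (All.lookup x∉xs v∈xs)
  ... | inj₂ (there v∈vs) = ∈-++⁺ʳ us v∈vs

Unique-⊆⇒length≤ : {xs ys : List A} → Unique xs → xs ⊆ ys → length xs ≤ length ys
Unique-⊆⇒length≤ {xs = xs} {ys} uxs xs⊆ys =
  let zs , ys↭ = Unique-⊆⇒↭ uxs xs⊆ys in begin
  length xs               ≤⟨ m≤m+n _ _ ⟩
  length xs + length zs   ≡⟨ length-++ xs ⟨
  length (xs ++ zs)       ≡⟨ ↭-length ys↭ ⟨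
  length ys               ∎
  where open ≤-Reasoning

Unique-++⇒Disjoint : (xs : List A) {ys : List A} → Unique (xs ++ ys) → Disjoint xs ys
Unique-++⇒Disjoint (x ∷ xs) (x∉ ∷ _) (here refl , v∈ys) = All.lookup (Allₚ.++⁻ʳ xs x∉) v∈ys refl
Unique-++⇒Disjoint (x ∷ xs) (_ ∷ u) (there v∈xs , v∈ys) = Unique-++⇒Disjoint xs u (v∈xs , v∈ys)

Unique-resp-↭ : {xs ys : List A} → xs ↭ ys → Unique xs → Unique ys
Unique-resp-↭ p = Setoid↭.Unique-resp-↭ (≡-setoid _) (↭.↭⇒↭ₛ p)

take-drop-disjoint : (k : ℕ) {xs : List A} → Unique xs → Disjoint (take k xs) (drop k xs)
take-drop-disjoint k {xs} u =
  Unique-++⇒Disjoint (take k xs) (subst Unique (sym (take++drop≡id k xs)) u)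

Disjoint-++ˡ : (us {vs ws} : List A) → Disjoint us ws → Disjoint vs ws → Disjoint (us ++ vs) ws
Disjoint-++ˡ us us#ws vs#ws (v∈ , v∈ws) with ∈-++⁻ us v∈
... | inj₁ v∈us = us#ws (v∈us , v∈ws)
... | inj₂ v∈vs = vs#ws (v∈vs , v∈ws)

concat-↭ : {xss yss : List (List A)} → xss ↭ yss → concat xss ↭ concat yss
concat-↭ ↭.refl = ↭-refl
concat-↭ (↭.prep xs p) = ↭ₚ.++⁺ˡ xs (concat-↭ p)
concat-↭ (↭.swap xs ys p) = ↭-trans (shifts xs ys) (↭ₚ.++⁺ˡ ys (↭ₚ.++⁺ˡ xs (concat-↭ p)))
concat-↭ (↭.trans p q) = ↭-trans (concat-↭ p) (concat-↭ q)

length-concat : (z : ℕ) {xss : List (List A)} → All (λ xs → length xs ≡ z) xss →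
  length (concat xss) ≡ length xss * z
length-concat z [] = refl
length-concat z {xs ∷ xss} (refl ∷ eqs) = trans (length-++ xs) (cong (z +_) (length-concat z eqs))

-- Counting in lists

module _ {P : A → Set} (P? : Decidable P) where

  count : List A → ℕ
  count xs = length (filter P? xs)

  count-++ : ∀ xs ys → count (xs ++ ys) ≡ count xs + count ys
  count-++ xs ys = trans (cong length (filter-++ P? xs ys)) (length-++ (filter P? xs))

  count-↭ : ∀ {xs ys} → xs ↭ ys → count xs ≡ count ys
  count-↭ p = ↭-length (filter-↭ P? p)

  count-all : ∀ {xs} → All P xs → count xs ≡ length xs
  count-all pxs = cong length (filter-all P? pxs)

count-Unique : {P : Fin n → Set} (P? : Decidable P) {xs : List (Fin n)} → Unique xs →
  count P? xs ≤ count P? (allFin n)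
count-Unique {n} P? {xs} uxs =
  let zs , all↭ = Unique-⊆⇒↭ uxs (λ {v} _ → ∈-allFin v) in begin
  count P? xs                 ≤⟨ m≤m+n _ _ ⟩
  count P? xs + count P? zs   ≡⟨ count-++ P? xs zs ⟨
  count P? (xs ++ zs)         ≡⟨ count-↭ P? all↭ ⟨
  count P? (allFin n)         ∎
  where open ≤-Reasoning

module _ (a : Fin n → Fin ℓ) where

  at : Fin ℓ → List (Fin n) → ℕ
  at s = count (λ v → a v ≟ s)

  Const : List (Fin n) → Set
  Const xs = ∃ λ s → All (λ v → a v ≡ s) xs

moved : (a b : Fin n → Fin ℓ) → List (Fin n) → ℕ
moved a b = count (λ v → ¬? (a v ≟ b v))

at-cong : (a b : Fin n → Fin ℓ) (s : Fin ℓ) {xs : List (Fin n)} →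
  All (λ v → a v ≡ b v) xs → at a s xs ≡ at b s xs
at-cong a b s [] = refl
at-cong a b s {x ∷ xs} (eq ∷ eqs) with ih ← at-cong a b s eqs | a x ≟ s | b x ≟ s
... | yes _   | yes _   = cong suc ih
... | yes ax≡ | no bx≢  = contradiction (trans (sym eq) ax≡) bx≢
... | no ax≢  | yes bx≡ = contradiction (trans eq bx≡) ax≢
... | no _    | no _    = ih

moved-refl : (a : Fin n → Fin ℓ) (xs : List (Fin n)) → moved a a xs ≡ 0
moved-refl a [] = refl
moved-refl a (x ∷ xs) with a x ≟ a x
... | yes _ = moved-refl a xs
... | no ≢  = contradiction refl ≢

moved-triangle : (a b c : Fin n → Fin ℓ) (xs : List (Fin n)) →
  moved a c xs ≤ moved a b xs + moved b c xs
moved-triangle a b c [] = z≤n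
moved-triangle a b c (x ∷ xs) with ih ← moved-triangle a b c xs | a x ≟ c x | a x ≟ b x | b x ≟ c x
... | yes _ | yes _ | yes _ = ih
... | yes _ | yes _ | no  _ = ≤-trans ih (+-monoʳ-≤ _ (n≤1+n _))
... | yes _ | no  _ | yes _ = ≤-trans ih (n≤1+n _)
... | yes _ | no  _ | no  _ = ≤-trans ih (≤-trans (+-monoʳ-≤ _ (n≤1+n _)) (n≤1+n _))
... | no ac | yes p | yes q = contradiction (trans p q) ac
... | no  _ | yes _ | no  _ = ≤-trans (s≤s ih) (≤-reflexive (sym (+-suc _ _)))
... | no  _ | no  _ | yes _ = s≤s ih
... | no  _ | no  _ | no  _ = s≤s (≤-trans ih (+-monoʳ-≤ _ (n≤1+n _)))

-- The common server under `b` differs from `s` or from `t`, so one of the two lists moves as a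
-- whole.
moved-merge : (a b : Fin n → Fin ℓ) {s t : Fin ℓ} {xs ys : List (Fin n)} {z : ℕ} → s ≢ t →
  All (λ v → a v ≡ s) xs → All (λ v → a v ≡ t) ys → length xs ≡ z → length ys ≡ z →
  Const b (xs ++ ys) → z ≤ moved a b (xs ++ ys)
moved-merge a b {s} {t} {xs} {ys} {z} s≢t as at′ refl eq (u , bu)
  with bxs ← Allₚ.++⁻ˡ xs bu | bys ← Allₚ.++⁻ʳ xs bu | s ≟ u
... | yes refl = begin
  z                              ≡⟨ eq ⟨
  length ys                      ≡⟨ count-all _ (All.zipWith (λ (p , q) r → s≢t (trans (sym q) (trans (sym r) p))) (at′ , bys)) ⟨
  moved a b ys                   ≤⟨ m≤n+m _ _ ⟩
  moved a b xs + moved a b ys    ≡⟨ count-++ _ xs ys ⟨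
  moved a b (xs ++ ys)           ∎
  where open ≤-Reasoning
... | no s≢u = begin
  z                              ≡⟨ count-all _ (All.zipWith (λ (p , q) r → s≢u (trans (sym p) (trans r q))) (as , bxs)) ⟨
  moved a b xs                   ≤⟨ m≤m+n _ _ ⟩
  moved a b xs + moved a b ys    ≡⟨ count-++ _ xs ys ⟨
  moved a b (xs ++ ys)           ∎
  where open ≤-Reasoning

-- Pairing

flatten : List (A × A) → List A
flatten [] = []
flatten ((x , y) ∷ ps) = x ∷ y ∷ flatten ps

flatten-++ : (ps qs : List (A × A)) → flatten (ps ++ qs) ≡ flatten ps ++ flatten qs
flatten-++ [] qs = refl
flatten-++ ((x , y) ∷ ps) qs = cong (λ xs → x ∷ y ∷ xs) (flatten-++ ps qs)

length-flatten : (ps : List (A × A)) → length (flatten ps) ≡ 2 * length ps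
length-flatten [] = refl
length-flatten (_ ∷ ps) = trans (cong (2 +_) (length-flatten ps)) (sym (*-suc 2 (length ps)))

pair-up : (h : ℕ) (xs : List A) → length xs ≡ 2 * h → ∃ λ ps → length ps ≡ h × flatten ps ≡ xs
pair-up zero [] _ = [] , refl , refl
pair-up (suc h) xs eq with xs | trans eq (*-suc 2 h)
... | x ∷ y ∷ ys | eq′ =
  let ps , len , fl = pair-up h ys (suc-injective (suc-injective eq′))
  in (x , y) ∷ ps , cong suc len , cong (λ zs → x ∷ y ∷ zs) fl

CrossPairing : (A → Fin ℓ) → List A → Set
CrossPairing f xs = ∃₂ λ ps rest → xs ↭ flatten ps ++ rest ×
  All (λ (x , y) → f x ≢ f y) ps × ∃ λ s → All (λ x → f x ≡ s) rest

-- Greedy: the unpaired elements always share one value of `f`, so a new element either joins them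
-- or forms a cross pair with one of them.
cross-pairing : (f : A → Fin (suc ℓ)) (xs : List A) → CrossPairing f xs
-- An empty remainder still has to name a value, which is why the range is `Fin (suc ℓ)`.
cross-pairing f [] = [] , [] , ↭-refl , [] , zero , []
cross-pairing f (x ∷ xs) with cross-pairing f xs
... | ps , [] , perm , cross , s , [] =
  ps , [ x ] , ↭-trans (↭-prep x perm) (↭-sym (shift x (flatten ps) [])) , cross , f x , refl ∷ []
... | ps , y ∷ ys , perm , cross , s , (refl ∷ same) with f x ≟ f y
...   | yes fx≡fy = ps , x ∷ y ∷ ys , ↭-trans (↭-prep x perm) (↭-sym (shift x (flatten ps) (y ∷ ys)))
                  , cross , f y , fx≡fy ∷ refl ∷ same
...   | no fx≢fy = (x , y) ∷ ps , ys , ↭-prep x (↭-trans perm (shift y (flatten ps) ys))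
                 , fx≢fy ∷ cross , f y , same

merge : List (List A × List A) → List (List A)
merge = map (uncurry _++_)

concat-merge : (ps : List (List A × List A)) → concat (merge ps) ≡ concat (flatten ps)
concat-merge [] = refl
concat-merge ((x , y) ∷ ps) = trans (cong ((x ++ y) ++_) (concat-merge ps)) (++-assoc x y _)

-- Comparing assignments that agree outside a small set

at-const : (a b : Fin n → Fin ℓ) (s : Fin ℓ) {t : Fin ℓ} {xs ys : List (Fin n)} →
  All (λ v → a v ≡ t) xs → All (λ v → b v ≡ t) ys → length xs ≡ length ys →
  at a s xs ≡ at b s ys
at-const a b s {t} {xs} {ys} axs bys eq with t ≟ s
... | yes refl = trans (count-all _ axs) (trans eq (sym (count-all _ bys)))
... | no t≢s   = trans (none a axs) (sym (none b bys))
  where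
  none : (c : Fin _ → Fin _) {zs : List (Fin _)} → All (λ v → c v ≡ t) zs → at c s zs ≡ 0
  none c czs = cong length (filter-none (λ v → c v ≟ s) (All.map (λ cv cs → t≢s (trans (sym cv) cs)) czs))

module _ (a b : Fin n → Fin ℓ) {W : List (Fin n)} (uW : Unique W)
         (agree : ∀ v → v ∉ W → a v ≡ b v) where

  -- Outside `W` the assignments agree, so a load can change only through `W`. In this way the
  -- offline solution inherits its loads from the balanced initial assignment.
  at-exchange : (s : Fin ℓ) → at a s W ≡ at b s W → at a s (allFin n) ≡ at b s (allFin n)
  at-exchange s eqW =
    let zs , all↭ = Unique-⊆⇒↭ uW (λ {v} _ → ∈-allFin v)
        W#zs = Unique-++⇒Disjoint W (Unique-resp-↭ all↭ (Uniqueₚ.allFin⁺ n))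
        eqzs = at-cong a b s (All.tabulate {xs = zs} λ v∈zs → agree _ (λ v∈W → W#zs (v∈W , v∈zs)))
    in begin
    at a s (allFin n)        ≡⟨ count-↭ _ all↭ ⟩
    at a s (W ++ zs)         ≡⟨ count-++ _ W zs ⟩
    at a s W + at a s zs     ≡⟨ cong₂ _+_ eqW eqzs ⟩
    at b s W + at b s zs     ≡⟨ count-++ _ W zs ⟨
    at b s (W ++ zs)         ≡⟨ count-↭ _ all↭ ⟨
    at b s (allFin n)        ∎
    where open ≡-Reasoning

  moved≤length : moved a b (allFin n) ≤ length W
  moved≤length = Unique-⊆⇒length≤ (Uniqueₚ.filter⁺ _ (Uniqueₚ.allFin⁺ n)) moved⊆W
    where
    moved⊆W : filter (λ v → ¬? (a v ≟ b v)) (allFin n) ⊆ W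
    moved⊆W {v} v∈ with _∈?_ _≟_ v W
    ... | yes v∈W = v∈W
    ... | no v∉W = contradiction (agree v v∉W) (proj₂ (∈-filter⁻ (λ w → ¬? (a w ≟ b w)) {xs = allFin n} v∈))

-- Requests gluing a list of vertices together

Respects : (Fin n → Fin ℓ) → List (Fin n × Fin n) → Set
Respects a = All (λ (u , v) → a u ≡ a v)

-- A star centred at the first vertex is enough to connect the list. Lists with at most one vertex
-- yield no request.
star : List (Fin n) → List (Fin n × Fin n)
star [] = []
star (x ∷ xs) = map (x ,_) xs

glue : List (List (Fin n)) → List (Fin n × Fin n)
glue = concatMap star

module _ (a : Fin n → Fin (suc ℓ)) where

  Respects-star⇒Const : (xs : List (Fin n)) → Respects a (star xs) → Const a xs
  Respects-star⇒Const [] _ = zero , []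
  Respects-star⇒Const (x ∷ xs) r = a x , refl ∷ All.map sym (Allₚ.map⁻ r)

  Const⇒Respects-star : (xs : List (Fin n)) → Const a xs → Respects a (star xs)
  Const⇒Respects-star [] _ = []
  Const⇒Respects-star (x ∷ xs) (s , ax ∷ axs) = Allₚ.map⁺ (All.map (λ av → trans ax (sym av)) axs)

  Respects-glue⇒Const : (Q : List (List (Fin n))) → Respects a (glue Q) → All (Const a) Q
  Respects-glue⇒Const [] _ = []
  Respects-glue⇒Const (xs ∷ Q) r =
    Respects-star⇒Const xs (Allₚ.++⁻ˡ (star xs) r) ∷ Respects-glue⇒Const Q (Allₚ.++⁻ʳ (star xs) r)

  Const⇒Respects-glue : (Q : List (List (Fin n))) → All (Const a) Q → Respects a (glue Q)
  Const⇒Respects-glue [] [] = []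
  Const⇒Respects-glue (xs ∷ Q) (c ∷ cs) = Allₚ.++⁺ (Const⇒Respects-star xs c) (Const⇒Respects-glue Q cs)

  Const-⊆ : {xs ys : List (Fin n)} → xs ⊆ ys → Const a ys → Const a xs
  Const-⊆ xs⊆ys (s , all) = s , All.tabulate (λ v∈xs → All.lookup all (xs⊆ys v∈xs))

  Const-merge⇒flatten : (ps : List (List (Fin n) × List (Fin n))) →
    All (Const a) (merge ps) → All (Const a) (flatten ps)
  Const-merge⇒flatten [] [] = []
  Const-merge⇒flatten ((x , y) ∷ ps) (c ∷ cs) =
    Const-⊆ ∈-++⁺ˡ c ∷ Const-⊆ (∈-++⁺ʳ x) c ∷ Const-merge⇒flatten ps cs

-- Schedules and their costs

take-++ : (i : ℕ) (xs ys : List A) → i ≤ length xs → take i (xs ++ ys) ≡ take i xs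
take-++ zero xs ys _ = refl
take-++ (suc i) (x ∷ xs) ys (s≤s i≤) = cong (x ∷_) (take-++ i xs ys i≤)

module _ {ℓ k : ℕ} where

  CC⇒Respects : {E : List (Edge ℓ k)} {a : Assignment ℓ k} → CC {ℓ} {k} E a → Respects a E
  CC⇒Respects cc = All.tabulate λ {(u , v)} e∈E → cc u v (step here (inj₁ e∈E))

  Respects⇒CC : {E : List (Edge ℓ k)} {a : Assignment ℓ k} → Respects a E → CC {ℓ} {k} E a
  Respects⇒CC r u .u here = refl
  Respects⇒CC r u v (step {w} c (inj₁ e∈E)) = trans (Respects⇒CC r u w c) (All.lookup r e∈E)
  Respects⇒CC r u v (step {w} c (inj₂ e∈E)) = trans (Respects⇒CC r u w c) (sym (All.lookup r e∈E))

  schedCost-cong : {s s′ : ℕ → Assignment ℓ k} (m : ℕ) → (∀ i → i ≤ m → s i ≡ s′ i) →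
    schedCost {ℓ} {k} s m ≡ schedCost {ℓ} {k} s′ m
  schedCost-cong zero eq = refl
  schedCost-cong (suc m) eq =
    cong₂ _+_ (schedCost-cong m (λ i i≤m → eq i (m≤n⇒m≤1+n i≤m)))
              (cong₂ (dist {ℓ} {k}) (eq m (n≤1+n m)) (eq (suc m) ≤-refl))

  -- By the triangle inequality detours never cost less than the direct distance. A batch of
  -- requests can thus be charged by comparing the configurations before and after it.
  schedCost-+ : (s : ℕ → Assignment ℓ k) (m i : ℕ) →
    schedCost {ℓ} {k} s m + dist {ℓ} {k} (s m) (s (m + i)) ≤ schedCost {ℓ} {k} s (m + i)
  schedCost-+ s m zero rewrite +-identityʳ m | moved-refl (s m) (allFin (ℓ * k)) =
    ≤-reflexive (+-identityʳ _)
  schedCost-+ s m (suc i) rewrite +-suc m i = begin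
    c + d (s m) (s (suc (m + i)))                             ≤⟨ +-monoʳ-≤ c (moved-triangle (s m) (s (m + i)) (s (suc (m + i))) (allFin (ℓ * k))) ⟩
    c + (d (s m) (s (m + i)) + d (s (m + i)) (s (suc (m + i))))   ≡⟨ +-assoc c _ _ ⟨
    c + d (s m) (s (m + i)) + d (s (m + i)) (s (suc (m + i)))     ≤⟨ +-monoˡ-≤ _ (schedCost-+ s m i) ⟩
    schedCost {ℓ} {k} s (suc (m + i))                         ∎
    where
    open ≤-Reasoning
    c = schedCost {ℓ} {k} s m
    d = dist {ℓ} {k}

  module _ (alg : OnlineAlg ℓ k) (a₀ : Assignment ℓ k) where

    current : List (Edge ℓ k) → Assignment ℓ k
    current E = onlSched {ℓ} {k} alg a₀ E (length E)

    -- The replies depend only on the prefix revealed so far, so the schedules for `E` and `E ++ F`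
    -- agree during the first `length E` requests.
    onlCost-++ : (E F : List (Edge ℓ k)) →
      onlCost {ℓ} {k} alg a₀ E + dist {ℓ} {k} (current E) (current (E ++ F)) ≤ onlCost {ℓ} {k} alg a₀ (E ++ F)
    onlCost-++ E F = begin
      schedCost {ℓ} {k} (sched E) m + dist {ℓ} {k} (sched E m) (sched (E ++ F) (length (E ++ F)))
        ≡⟨ cong₂ _+_ (schedCost-cong m prefix) (cong₂ (dist {ℓ} {k}) (prefix m ≤-refl) (cong (sched (E ++ F)) (length-++ E))) ⟩
      schedCost {ℓ} {k} (sched (E ++ F)) m + dist {ℓ} {k} (sched (E ++ F) m) (sched (E ++ F) (m + length F))
        ≤⟨ schedCost-+ (sched (E ++ F)) m (length F) ⟩
      schedCost {ℓ} {k} (sched (E ++ F)) (m + length F)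
        ≡⟨ cong (schedCost {ℓ} {k} (sched (E ++ F))) (length-++ E) ⟨
      schedCost {ℓ} {k} (sched (E ++ F)) (length (E ++ F)) ∎
      where
      open ≤-Reasoning
      m = length E
      sched = onlSched {ℓ} {k} alg a₀
      prefix : ∀ i → i ≤ m → sched E i ≡ sched (E ++ F) i
      prefix zero _ = refl
      prefix (suc i) i≤m = cong (alg a₀) (sym (take-++ (suc i) E F i≤m))

    -- Before the first request the configuration is `a₀`, about which `IsOnlineAlg` says nothing;
    -- hence the condition that `E` is nonempty.
    current-admissible : {cap : ℕ} → IsOnlineAlg ℓ k cap alg → Balanced {ℓ} {k} a₀ →
      (E : List (Edge ℓ k)) → 0 < length E → ValidSeq {ℓ} {k} E → Admissible {ℓ} {k} cap E (current E)
    current-admissible {cap} online balanced (e ∷ σ) _ valid =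
      subst (λ F → Admissible {ℓ} {k} cap (e ∷ σ) (alg a₀ (e ∷ F)))
            (sym (take-all (length σ) σ ≤-refl)) (online a₀ balanced e σ valid)

-- The counter of remaining rounds

total : (Fin n → ℕ) → ℕ
total g = sum (tabulate g)

total-decrease : {g g′ : Fin n → ℕ} (i : Fin n) → g i ≡ suc (g′ i) → (∀ j → j ≢ i → g′ j ≡ g j) →
  total g ≡ suc (total g′)
total-decrease zero eq others =
  cong₂ _+_ eq (cong sum (tabulate-cong (λ j → sym (others (suc j) λ ()))))
total-decrease {g = g} {g′} (suc i) eq others =
  trans (cong₂ _+_ (sym (others zero λ ())) (total-decrease i eq (λ j j≢i → others (suc j) (j≢i ∘ Fin.suc-injective))))
        (+-suc (g′ zero) _)

total-const : (n c : ℕ) → total {n} (λ _ → c) ≡ n * c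
total-const zero c = refl
total-const (suc n) c = cong (c +_) (total-const n c)

-- The instance

-- Each server starts with 2p vertices (index set IA) forming one of the sets X (suc r), p further
-- vertices (IC), and a large block B r (IB). The IC vertices of servers 0 and 1 form X zero, those
-- of the other servers are never requested.
module Instance (ℓ′ k p : ℕ) (3p≤k : 2 * p + p ≤ k) where

  ℓ₂ : ℕ
  ℓ₂ = suc (suc ℓ′)

  V : Set
  V = Vertex ℓ₂ k

  a₀ : Assignment ℓ₂ k
  a₀ v = proj₁ (remQuot {ℓ₂} k v)

  cell : Fin ℓ₂ → List (Fin k) → List V
  cell r = map (combine r)

  IA ICB IC IB : List (Fin k)
  IA  = take (2 * p) (allFin k)
  ICB = drop (2 * p) (allFin k)
  IC  = take p ICB
  IB  = drop p ICB

  B : Fin ℓ₂ → List V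
  B r = cell r IB

  X : Fin (suc ℓ₂) → List V
  X zero    = cell zero IC ++ cell (suc zero) IC
  X (suc r) = cell r IA

  a₀-cell : ∀ r js → All (λ v → a₀ v ≡ r) (cell r js)
  a₀-cell r js = Allₚ.map⁺ (All.tabulate λ {j} _ → cong proj₁ (remQuot-combine {ℓ₂} r j))

  cell-unique : ∀ r {js} → Unique js → Unique (cell r js)
  cell-unique r = Uniqueₚ.map⁺ (λ {i} {j} → Fin.combine-injectiveʳ r i r j)

  cell-disjoint-server : ∀ r s {is js} → r ≢ s → Disjoint (cell r is) (cell s js)
  cell-disjoint-server r s r≢s (v∈r , v∈s) =
    r≢s (trans (sym (All.lookup (a₀-cell _ _) v∈r)) (All.lookup (a₀-cell _ _) v∈s))

  cell-disjoint-index : ∀ r s {is js} → Disjoint is js → Disjoint (cell r is) (cell s js)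
  cell-disjoint-index r s is#js (v∈r , v∈s)
    with i , i∈is , refl ← ∈-map⁻ (combine r) v∈r
    with j , j∈js , eq ← ∈-map⁻ (combine s) v∈s
    with refl ← Fin.combine-injectiveʳ r i s j eq = is#js (i∈is , j∈js)

  IA#ICB : Disjoint IA ICB
  IA#ICB = take-drop-disjoint (2 * p) (Uniqueₚ.allFin⁺ k)

  ICB-unique : Unique ICB
  ICB-unique = Uniqueₚ.drop⁺ (2 * p) (Uniqueₚ.allFin⁺ k)

  IC⊆ICB : IC ⊆ ICB
  IC⊆ICB v∈ = subst (_ ∈_) (take++drop≡id p ICB) (∈-++⁺ˡ v∈)

  IB⊆ICB : IB ⊆ ICB
  IB⊆ICB v∈ = subst (_ ∈_) (take++drop≡id p ICB) (∈-++⁺ʳ IC v∈)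

  IC#IA : Disjoint IC IA
  IC#IA (v∈IC , v∈IA) = IA#ICB (v∈IA , IC⊆ICB v∈IC)

  IA#IB : Disjoint IA IB
  IA#IB (v∈IA , v∈IB) = IA#ICB (v∈IA , IB⊆ICB v∈IB)

  IC#IB : Disjoint IC IB
  IC#IB = take-drop-disjoint p ICB-unique

  X-unique : ∀ i → Unique (X i)
  X-unique zero = Uniqueₚ.++⁺ (cell-unique zero uIC) (cell-unique (suc zero) uIC)
    (cell-disjoint-server zero (suc zero) λ ())
    where uIC = Uniqueₚ.take⁺ p ICB-unique
  X-unique (suc r) = cell-unique r (Uniqueₚ.take⁺ (2 * p) (Uniqueₚ.allFin⁺ k))

  B-unique : ∀ r → Unique (B r)
  B-unique r = cell-unique r (Uniqueₚ.drop⁺ p ICB-unique)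

  X₀#X : ∀ r → Disjoint (X zero) (X (suc r))
  X₀#X r = Disjoint-++ˡ (cell zero IC) (cell-disjoint-index zero r IC#IA) (cell-disjoint-index (suc zero) r IC#IA)

  X-disjoint : ∀ i j → i ≢ j → Disjoint (X i) (X j)
  X-disjoint zero    zero    i≢j = contradiction refl i≢j
  X-disjoint zero    (suc s) i≢j = X₀#X s
  X-disjoint (suc r) zero    i≢j = λ (v∈X , v∈X₀) → X₀#X r (v∈X₀ , v∈X)
  X-disjoint (suc r) (suc s) i≢j = cell-disjoint-server r s (i≢j ∘ cong suc)

  X#B : ∀ i r → Disjoint (X i) (B r)
  X#B zero    r = Disjoint-++ˡ (cell zero IC) (cell-disjoint-index zero r IC#IB) (cell-disjoint-index (suc zero) r IC#IB)
  X#B (suc s) r = cell-disjoint-index s r IA#IB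

  length-ICB : length ICB ≡ k ∸ 2 * p
  length-ICB = trans (length-drop (2 * p) (allFin k)) (cong (_∸ 2 * p) (length-tabulate {n = k} id))

  length-IC : length IC ≡ p
  length-IC = trans (length-take p ICB) (m≤n⇒m⊓n≡m (subst (p ≤_) (sym length-ICB) (m+n≤o⇒m≤o∸n p (subst (_≤ k) (+-comm (2 * p) p) 3p≤k))))

  length-cellC : ∀ r → length (cell r IC) ≡ p
  length-cellC r = trans (length-map (combine r) IC) length-IC

  length-B : ∀ r → length (B r) ≡ k ∸ (2 * p + p)
  length-B r = begin
    length (B r)          ≡⟨ length-map (combine r) IB ⟩
    length IB             ≡⟨ length-drop p ICB ⟩
    length ICB ∸ p        ≡⟨ cong (_∸ p) length-ICB ⟩
    k ∸ 2 * p ∸ p         ≡⟨ ∸-+-assoc k (2 * p) p ⟩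
    k ∸ (2 * p + p)       ∎
    where open ≡-Reasoning

  length-X : ∀ i → length (X i) ≡ 2 * p
  length-X zero = begin
    length (X zero)           ≡⟨ length-++ (cell zero IC) ⟩
    length (cell zero IC) + length (cell (suc zero) IC) ≡⟨ cong₂ _+_ (length-cellC zero) (length-cellC (suc zero)) ⟩
    p + p                     ≡⟨ cong (p +_) (+-identityʳ p) ⟨
    2 * p                     ∎
    where open ≡-Reasoning
  length-X (suc r) = begin
    length (cell r IA)            ≡⟨ length-map (combine r) IA ⟩
    length IA                     ≡⟨ length-take (2 * p) (allFin k) ⟩
    2 * p ⊓ length (allFin k)     ≡⟨ cong (2 * p Data.Nat.⊓_) (length-tabulate {n = k} id) ⟩
    2 * p ⊓ k                     ≡⟨ m≤n⇒m⊓n≡m (m+n≤o⇒m≤o (2 * p) 3p≤k) ⟩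
    2 * p                         ∎
    where open ≡-Reasoning

  a₀-balanced : Balanced {ℓ₂} {k} a₀
  a₀-balanced s = ≤-antisym upper lower
    where
    all = cell s (allFin k)
    len : length all ≡ k
    len = trans (length-map (combine s) (allFin k)) (length-tabulate {n = k} id)
    upper : at a₀ s (allFin (ℓ₂ * k)) ≤ k
    upper = subst (at a₀ s (allFin (ℓ₂ * k)) ≤_) len (Unique-⊆⇒length≤ (Uniqueₚ.filter⁺ _ (Uniqueₚ.allFin⁺ _)) sub)
      where
      sub : filter (λ v → a₀ v ≟ s) (allFin (ℓ₂ * k)) ⊆ all
      sub {v} v∈ with refl ← proj₂ (∈-filter⁻ (λ w → a₀ w ≟ s) {xs = allFin (ℓ₂ * k)} v∈) =
        subst (_∈ all) (combine-remQuot {ℓ₂} k v) (∈-map⁺ (combine s) (∈-allFin (proj₂ (remQuot {ℓ₂} k v))))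
    lower : k ≤ at a₀ s (allFin (ℓ₂ * k))
    lower = subst (_≤ at a₀ s (allFin (ℓ₂ * k))) (trans (count-all _ (a₀-cell s (allFin k))) len)
      (count-Unique (λ v → a₀ v ≟ s) (cell-unique s (Uniqueₚ.allFin⁺ k)))

  -- The offline solution

  -- The cheap offline solution when only X t is not glued together: its two halves
  -- take over the room freed by X zero on servers 0 and 1, and X zero moves to the
  -- server where X t started.
  module Offline (t : Fin (suc ℓ₂)) (q₁ q₂ : List V) (len₁ : length q₁ ≡ p) (len₂ : length q₂ ≡ p)
                 (q↭X : q₁ ++ q₂ ↭ X t) where

    -- The value at `zero` is a default: if `t` is `zero`, the two halves cover `X zero`, and `opt`
    -- tests for them first.
    home : Fin (suc ℓ₂) → Fin ℓ₂
    home zero    = zero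
    home (suc r) = r

    opt : Assignment ℓ₂ k
    opt v with _∈?_ _≟_ v q₁ | _∈?_ _≟_ v q₂ | _∈?_ _≟_ v (X zero)
    ... | yes _ | _     | _     = zero
    ... | no  _ | yes _ | _     = suc zero
    ... | no  _ | no  _ | yes _ = home t
    ... | no  _ | no  _ | no  _ = a₀ v

    q₁⊆X : q₁ ⊆ X t
    q₁⊆X = ∈-resp-↭ q↭X ∘ ∈-++⁺ˡ

    q₂⊆X : q₂ ⊆ X t
    q₂⊆X = ∈-resp-↭ q↭X ∘ ∈-++⁺ʳ q₁

    opt-q₁ : All (λ v → opt v ≡ zero) q₁
    opt-q₁ = All.tabulate lem
      where
      lem : ∀ {v} → v ∈ q₁ → opt v ≡ zero
      lem {v} v∈q₁ with _∈?_ _≟_ v q₁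
      ... | yes _ = refl
      ... | no v∉q₁ = contradiction v∈q₁ v∉q₁

    opt-q₂ : All (λ v → opt v ≡ suc zero) q₂
    opt-q₂ = All.tabulate lem
      where
      q₁#q₂ : Disjoint q₁ q₂
      q₁#q₂ = Unique-++⇒Disjoint q₁ (Unique-resp-↭ (↭-sym q↭X) (X-unique t))
      lem : ∀ {v} → v ∈ q₂ → opt v ≡ suc zero
      lem {v} v∈q₂ with _∈?_ _≟_ v q₁ | _∈?_ _≟_ v q₂
      ... | yes v∈q₁ | _ = contradiction (v∈q₁ , v∈q₂) q₁#q₂
      ... | no _ | yes _ = refl
      ... | no _ | no v∉q₂ = contradiction v∈q₂ v∉q₂

    opt-X₀ : t ≢ zero → All (λ v → opt v ≡ home t) (X zero)
    opt-X₀ t≢0 = All.tabulate lem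
      where
      lem : ∀ {v} → v ∈ X zero → opt v ≡ home t
      lem {v} v∈X₀ with _∈?_ _≟_ v q₁ | _∈?_ _≟_ v q₂ | _∈?_ _≟_ v (X zero)
      ... | yes v∈q₁ | _ | _ = contradiction (q₁⊆X v∈q₁ , v∈X₀) (X-disjoint t zero t≢0)
      ... | no _ | yes v∈q₂ | _ = contradiction (q₂⊆X v∈q₂ , v∈X₀) (X-disjoint t zero t≢0)
      ... | no _ | no _ | yes _ = refl
      ... | no _ | no _ | no v∉X₀ = contradiction v∈X₀ v∉X₀

    opt-else : ∀ v → v ∉ X t → v ∉ X zero → opt v ≡ a₀ v
    opt-else v v∉Xt v∉X₀ with _∈?_ _≟_ v q₁ | _∈?_ _≟_ v q₂ | _∈?_ _≟_ v (X zero)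
    ... | yes v∈q₁ | _ | _ = contradiction (q₁⊆X v∈q₁) v∉Xt
    ... | no _ | yes v∈q₂ | _ = contradiction (q₂⊆X v∈q₂) v∉Xt
    ... | no _ | no _ | yes v∈X₀ = contradiction v∈X₀ v∉X₀
    ... | no _ | no _ | no _ = refl

    opt-cell : ∀ r js → Disjoint (X t) (cell r js) → Disjoint (X zero) (cell r js) → Const opt (cell r js)
    opt-cell r js Xt# X₀# = r , All.tabulate λ {v} v∈ →
      trans (opt-else v (λ v∈Xt → Xt# (v∈Xt , v∈)) (λ v∈X₀ → X₀# (v∈X₀ , v∈))) (All.lookup (a₀-cell r js) v∈)

    opt-X : ∀ i → i ≢ t → Const opt (X i)
    opt-X zero    0≢t = home t , opt-X₀ (0≢t ∘ sym)
    opt-X (suc r) i≢t = opt-cell r IA (X-disjoint t (suc r) (i≢t ∘ sym)) (X₀#X r)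

    opt-B : ∀ r → Const opt (B r)
    opt-B r = opt-cell r IB (X#B t r) (X#B zero r)

    -- Initially `X zero` has `p` vertices on each of servers 0 and 1, and the two halves of `X t`
    -- fill exactly these places.
    halves : ∀ s → at a₀ s (X zero) ≡ at opt s (X t)
    halves s = begin
      at a₀ s (X zero)
        ≡⟨ count-++ _ (cell zero IC) (cell (suc zero) IC) ⟩
      at a₀ s (cell zero IC) + at a₀ s (cell (suc zero) IC)
        ≡⟨ cong₂ _+_ (at-const a₀ opt s (a₀-cell zero IC) opt-q₁ (trans (length-cellC zero) (sym len₁)))
                     (at-const a₀ opt s (a₀-cell (suc zero) IC) opt-q₂ (trans (length-cellC (suc zero)) (sym len₂))) ⟩
      at opt s q₁ + at opt s q₂
        ≡⟨ count-++ _ q₁ q₂ ⟨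
      at opt s (q₁ ++ q₂)
        ≡⟨ count-↭ _ q↭X ⟩
      at opt s (X t) ∎
      where open ≡-Reasoning

    -- `W` contains all vertices that may move: `X zero` alone if `t` is `zero`, otherwise `X t` and
    -- `X zero`, which exchange their places. The equation `t ≡ u` allows a case distinction on the
    -- module parameter `t`.
    changed : ∀ u → t ≡ u → ∃ λ W → Unique W × (∀ v → v ∉ W → a₀ v ≡ opt v) ×
      (∀ s → at a₀ s W ≡ at opt s W) × length W ≤ 4 * p
    changed zero t≡ = X zero , X-unique zero , (λ v v∉ → sym (opt-else v (subst (λ i → v ∉ X i) (sym t≡) v∉) v∉))
               , (λ s → trans (halves s) (cong (at opt s ∘ X) t≡))
               , subst (_≤ 4 * p) (sym (length-X zero)) (*-monoˡ-≤ p {2} {4} (s≤s (s≤s z≤n)))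
    changed (suc r) t≡ = X (suc r) ++ X zero , Uniqueₚ.++⁺ (X-unique (suc r)) (X-unique zero) (X-disjoint (suc r) zero λ ())
               , (λ v v∉ → sym (opt-else v (subst (λ i → v ∉ X i) (sym t≡) (v∉ ∘ ∈-++⁺ˡ)) (v∉ ∘ ∈-++⁺ʳ (X (suc r)))))
               , balance
               , ≤-reflexive (trans (length-++ (X (suc r))) (trans (cong₂ _+_ (length-X (suc r)) (length-X zero))
                   (sym (*-distribʳ-+ p 2 2))))
      where
      t≢0 : t ≢ zero
      t≢0 t≡0 with () ← trans (sym t≡) t≡0
      balance : ∀ s → at a₀ s (X (suc r) ++ X zero) ≡ at opt s (X (suc r) ++ X zero)
      balance s = begin
        at a₀ s (X (suc r) ++ X zero)           ≡⟨ count-++ _ (X (suc r)) (X zero) ⟩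
        at a₀ s (X (suc r)) + at a₀ s (X zero)
          ≡⟨ cong₂ _+_ (at-const a₀ opt s (a₀-cell r IA) (subst (λ i → All (λ v → opt v ≡ home i) (X zero)) t≡ (opt-X₀ t≢0))
                          (trans (length-X (suc r)) (sym (length-X zero))))
                       (trans (halves s) (cong (at opt s ∘ X) t≡)) ⟩
        at opt s (X zero) + at opt s (X (suc r)) ≡⟨ +-comm (at opt s (X zero)) _ ⟩
        at opt s (X (suc r)) + at opt s (X zero) ≡⟨ count-++ _ (X (suc r)) (X zero) ⟨
        at opt s (X (suc r) ++ X zero) ∎
        where open ≡-Reasoning

    opt-load : LoadBounded {ℓ₂} {k} k opt
    opt-load s = let W , uW , agree , eqW , _ = changed t refl in
      ≤-reflexive (trans (sym (at-exchange a₀ opt uW agree s (eqW s))) (a₀-balanced s))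

    opt-dist : dist {ℓ₂} {k} a₀ opt ≤ 4 * p
    opt-dist = let W , uW , agree , _ , len = changed t refl in ≤-trans (moved≤length a₀ opt uW agree) len

  -- Dividing a set into equal pieces

  -- g counts how many more times the pieces can be merged in pairs before only two are left.
  Pieces : ℕ → List V → List (List V) → Set
  Pieces g xs ps = length ps ≡ 2 * 2 ^ g × (∃ λ z → All (λ q → length q ≡ z) ps × z * 2 ^ g ≡ p) × concat ps ↭ xs

  merge-length : (z : ℕ) (prs : List (List V × List V)) → All (λ q → length q ≡ z) (flatten prs) →
    All (λ q → length q ≡ z * 2) (merge prs)
  merge-length z [] [] = []
  merge-length z ((x , y) ∷ prs) (lx ∷ ly ∷ ls) =
    trans (length-++ x) (trans (cong₂ _+_ lx ly) (sym (trans (*-comm z 2) (cong (z +_) (+-identityʳ z))))) ∷ merge-length z prs ls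

  Pieces-merge : ∀ {g xs ps} (prs : List (List V × List V)) → ps ↭ flatten prs →
    Pieces (suc g) xs ps → Pieces g xs (merge prs)
  Pieces-merge {g} {xs} {ps} prs perm (len , (z , lens , z*) , conc) =
    -- Merging in pairs halves the number of pieces and doubles `z`, whichever pieces are paired.
    *-cancelˡ-≡ _ _ 2 (begin
      2 * length (merge prs)    ≡⟨ cong (2 *_) (length-map (uncurry _++_) prs) ⟩
      2 * length prs            ≡⟨ length-flatten prs ⟨
      length (flatten prs)      ≡⟨ ↭-length perm ⟨
      length ps                 ≡⟨ len ⟩
      2 * (2 * 2 ^ g)           ∎)
    , (z * 2 , merge-length z prs (All-resp-↭ perm lens) , trans (*-assoc z 2 (2 ^ g)) z*)
    , ↭-trans (↭-reflexive (concat-merge prs)) (↭-trans (concat-↭ (↭-sym perm)) conc)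
    where open ≡-Reasoning

  -- The last component expresses that the pieces refine the two halves: keeping each half together
  -- keeps every piece together.
  Halves : List V → List (List V) → Set
  Halves xs ps = ∃₂ λ q₁ q₂ → length q₁ ≡ p × length q₂ ≡ p × q₁ ++ q₂ ↭ xs ×
    (∀ (a : Assignment ℓ₂ k) → Const a q₁ → Const a q₂ → All (Const a) ps)

  -- Neighbouring pieces are merged until two are left; any such bisection suits the offline
  -- solution.
  Pieces⇒Halves : ∀ g {xs ps} → Pieces g xs ps → Halves xs ps
  Pieces⇒Halves zero {ps = q₁ ∷ q₂ ∷ []} (_ , (z , l₁ ∷ l₂ ∷ [] , z*) , conc) =
    q₁ , q₂ , trans l₁ z≡p , trans l₂ z≡p
    , ↭-trans (↭-reflexive (cong (q₁ ++_) (sym (++-identityʳ q₂)))) conc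
    , λ a c₁ c₂ → c₁ ∷ c₂ ∷ []
    where z≡p = trans (sym (*-identityʳ z)) z*
  Pieces⇒Halves (suc g) {ps = ps} pieces@(len , _) =
    let prs , _ , fl = pair-up (2 * 2 ^ g) ps len
        q₁ , q₂ , l₁ , l₂ , perm , const = Pieces⇒Halves g (Pieces-merge {g} prs (↭-reflexive (sym fl)) pieces)
    in q₁ , q₂ , l₁ , l₂ , perm
     , λ a c₁ c₂ → subst (All (Const a)) fl (Const-merge⇒flatten a prs (const a c₁ c₂))

  Pieces-⊆ : ∀ {g xs ps} → Pieces g xs ps → All (_⊆ xs) ps
  Pieces-⊆ (_ , _ , conc) = All.tabulate λ q∈ps v∈q → ∈-resp-↭ conc (∈-concat⁺′ v∈q q∈ps)

  -- Up to the gluing of the sets other than X t, the requests so far only glue pieces of X t.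
  Free : Fin (suc ℓ₂) → List (List V) → List (List V) → Set
  Free t ps Q = ∀ (a : Assignment ℓ₂ k) → (∀ i → i ≢ t → Const a (X i)) → (∀ r → Const a (B r)) →
    All (Const a) ps → All (Const a) Q

  CheapSolution : List (List V) → Set
  CheapSolution Q = Σ (Assignment ℓ₂ k) λ o → LoadBounded {ℓ₂} {k} k o × Respects o (glue Q) × dist {ℓ₂} {k} a₀ o ≤ 4 * p

  -- `opt` keeps together all blocks, all sets other than `X t`, and both halves of `X t`, hence all
  -- its pieces. By `Free` it then respects every request.
  cheap-solution : ∀ t {g ps Q} → Pieces g (X t) ps → Free t ps Q → CheapSolution Q
  cheap-solution t {g} {Q = Q} pieces free =
    let q₁ , q₂ , l₁ , l₂ , perm , const = Pieces⇒Halves g pieces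
        open Offline t q₁ q₂ l₁ l₂ perm
    in opt , opt-load
     , Const⇒Respects-glue opt Q (free opt opt-X opt-B (const opt (zero , opt-q₁) (suc zero , opt-q₂)))
     , opt-dist

  CheapSolution⇒ValidSeq : ∀ {Q} → CheapSolution Q → ValidSeq {ℓ₂} {k} (glue Q)
  CheapSolution⇒ValidSeq (o , loads , resp , _) = o , Respects⇒CC {ℓ₂} {k} resp , loads

  -- Merging the pieces of a spread-out set

  -- For a set of size `2 * p` the bound says that every server holds less than 7/8 of it, written
  -- without fractions.
  Spread : Assignment ℓ₂ k → List V → Set
  Spread a xs = ∀ s → 4 * at a s xs < 7 * p

  module _ (a : Assignment ℓ₂ k) where

    -- The server of a glued piece is read off its first vertex, with `zero` as the default for an
    -- empty list.
    label : List V → Fin ℓ₂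
    label [] = zero
    label (v ∷ _) = a v

    Const⇒label : {xs : List V} → Const a xs → All (λ v → a v ≡ label xs) xs
    Const⇒label {[]} _ = []
    Const⇒label {v ∷ xs} (s , refl ∷ all) = refl ∷ all

    moved-cross : (b : Assignment ℓ₂ k) (z : ℕ) (prs : List (List V × List V)) →
      All (λ q → length q ≡ z) (flatten prs) → All (Const a) (flatten prs) →
      All (λ (x , y) → label x ≢ label y) prs → All (Const b) (merge prs) →
      length prs * z ≤ moved a b (concat (merge prs))
    moved-cross b z [] _ _ _ _ = z≤n
    moved-cross b z ((x , y) ∷ prs) (lx ∷ ly ∷ ls) (cx ∷ cy ∷ cs) (x≢y ∷ cross) (cb ∷ cbs) = begin
      z + length prs * z
        ≤⟨ +-mono-≤ (moved-merge a b x≢y (Const⇒label cx) (Const⇒label cy) lx ly cb) (moved-cross b z prs ls cs cross cbs) ⟩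
      moved a b (x ++ y) + moved a b (concat (merge prs))
        ≡⟨ count-++ _ (x ++ y) (concat (merge prs)) ⟨
      moved a b (concat (merge ((x , y) ∷ prs))) ∎
      where open ≤-Reasoning

    -- Pieces left over by the cross pairing share one server, so they contain at most 7/8 of the
    -- `2 * p` vertices. The cross pairs contain the other p / 4 at least, and gluing a pair moves
    -- at least half of its vertices.
    merging : ∀ {g xs ps} → length xs ≡ 2 * p → Pieces (suc g) xs ps → All (Const a) ps → Spread a xs →
      ∃ λ prs → ps ↭ flatten prs × (∀ b → All (Const b) (merge prs) → p ≤ 8 * moved a b xs)
    merging {g} {xs} {ps} len-xs (len , (z , lens , z*) , conc) consts spread
      with cs , rest , perm , cross , s , same ← cross-pairing label ps
      -- The number of pieces is even, so the number of leftovers is even too, and they may be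
      -- paired arbitrarily.
      = let ds , _ , fl = pair-up (2 * 2 ^ g ∸ h) rest len-rest
            perm′ = ↭-trans perm (↭-reflexive (trans (cong (flatten cs ++_) (sym fl)) (sym (flatten-++ cs ds))))
        in cs ++ ds , perm′ , pay ds
      where
      h = length cs
      r = length rest

      len-split : 2 * h + r ≡ 2 * (2 * 2 ^ g)
      len-split = begin
        2 * h + r                    ≡⟨ cong (_+ r) (length-flatten cs) ⟨
        length (flatten cs) + r      ≡⟨ length-++ (flatten cs) ⟨
        length (flatten cs ++ rest)  ≡⟨ ↭-length perm ⟨
        length ps                    ≡⟨ len ⟩
        2 * (2 * 2 ^ g)              ∎
        where open ≡-Reasoning

      len-rest : r ≡ 2 * (2 * 2 ^ g ∸ h)
      len-rest = begin
        r                            ≡⟨ m+n∸m≡n (2 * h) r ⟨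
        2 * h + r ∸ 2 * h            ≡⟨ cong (_∸ 2 * h) len-split ⟩
        2 * (2 * 2 ^ g) ∸ 2 * h      ≡⟨ *-distribˡ-∸ 2 (2 * 2 ^ g) h ⟨
        2 * (2 * 2 ^ g ∸ h)          ∎
        where open ≡-Reasoning

      perm-lens = All-resp-↭ perm lens
      perm-consts = All-resp-↭ perm consts

      conc′ : concat (flatten cs) ++ concat rest ↭ xs
      conc′ = ↭-trans (↭-reflexive (concat-++ (flatten cs) rest)) (↭-trans (concat-↭ (↭-sym perm)) conc)

      volume : 2 * p ≡ 2 * (h * z) + r * z
      volume = begin
        2 * p                                             ≡⟨ len-xs ⟨
        length xs                                         ≡⟨ ↭-length conc′ ⟨
        length (concat (flatten cs) ++ concat rest)       ≡⟨ length-++ (concat (flatten cs)) ⟩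
        length (concat (flatten cs)) + length (concat rest)
          ≡⟨ cong₂ _+_ (length-concat z (Allₚ.++⁻ˡ (flatten cs) perm-lens)) (length-concat z (Allₚ.++⁻ʳ (flatten cs) perm-lens)) ⟩
        length (flatten cs) * z + r * z                   ≡⟨ cong (λ l → l * z + r * z) (length-flatten cs) ⟩
        2 * h * z + r * z                                 ≡⟨ cong (_+ r * z) (*-assoc 2 h z) ⟩
        2 * (h * z) + r * z                               ∎
        where open ≡-Reasoning

      rest≤ : r * z ≤ at a s xs
      rest≤ = begin
        r * z                              ≡⟨ length-concat z (Allₚ.++⁻ʳ (flatten cs) perm-lens) ⟨
        length (concat rest)               ≡⟨ count-all (λ v → a v ≟ s) (Allₚ.concat⁺ (All.zipWith at-s (Allₚ.++⁻ʳ (flatten cs) perm-consts , same))) ⟨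
        at a s (concat rest)               ≤⟨ m≤n+m _ _ ⟩
        at a s (concat (flatten cs)) + at a s (concat rest) ≡⟨ count-++ _ (concat (flatten cs)) (concat rest) ⟨
        at a s (concat (flatten cs) ++ concat rest)         ≡⟨ count-↭ _ conc′ ⟩
        at a s xs                          ∎
        where
        open ≤-Reasoning
        at-s : ∀ {q} → Const a q × label q ≡ s → All (λ v → a v ≡ s) q
        at-s (c , refl) = Const⇒label c

      enough : p ≤ 8 * (h * z)
      enough = +-cancelʳ-≤ (7 * p) p _ (begin
        p + 7 * p                              ≡⟨ *-assoc 4 2 p ⟩
        4 * (2 * p)                            ≡⟨ cong (4 *_) volume ⟩
        4 * (2 * (h * z) + r * z)              ≡⟨ *-distribˡ-+ 4 (2 * (h * z)) (r * z) ⟩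
        4 * (2 * (h * z)) + 4 * (r * z)        ≤⟨ +-mono-≤ (≤-reflexive (sym (*-assoc 4 2 (h * z)))) (≤-trans (*-monoʳ-≤ 4 rest≤) (<⇒≤ (spread s))) ⟩
        8 * (h * z) + 7 * p                    ∎)
        where open ≤-Reasoning

      pay : ∀ ds b → All (Const b) (merge (cs ++ ds)) → p ≤ 8 * moved a b xs
      pay ds b cb = begin
        p                                                 ≤⟨ enough ⟩
        8 * (h * z)                                       ≤⟨ *-monoʳ-≤ 8 (moved-cross b z cs (Allₚ.++⁻ˡ (flatten cs) perm-lens) (Allₚ.++⁻ˡ (flatten cs) perm-consts) cross (Allₚ.++⁻ˡ (merge cs) cb′)) ⟩
        8 * moved a b (concat (merge cs))                 ≤⟨ *-monoʳ-≤ 8 (m≤m+n (moved a b (concat (merge cs))) _) ⟩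
        8 * (moved a b (concat (merge cs)) + moved a b (concat rest))
          ≡⟨ cong (λ ys → 8 * (moved a b ys + moved a b (concat rest))) (concat-merge cs) ⟩
        8 * (moved a b (concat (flatten cs)) + moved a b (concat rest))
          ≡⟨ cong (8 *_) (trans (sym (count-++ _ (concat (flatten cs)) (concat rest))) (count-↭ _ conc′)) ⟩
        8 * moved a b xs ∎
        where
        open ≤-Reasoning
        cb′ : All (Const b) (merge cs ++ merge ds)
        cb′ = subst (All (Const b)) (map-++ (uncurry _++_) cs ds) cb

  -- Some set is spread out

  length-B+3p : ∀ r → length (B r) + (2 * p + p) ≡ k
  length-B+3p r = trans (cong (_+ (2 * p + p)) (length-B r)) (m∸n+n≡m 3p≤k)

  module _ (e : ℕ) (2e<p : 2 * e < p) (8p≤k : 8 * p ≤ k) (a : Assignment ℓ₂ k)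
           (loads : LoadBounded {ℓ₂} {k} (k + e) a) (constB : ∀ r → Const a (B r)) where

    -- Two sets with 7/8 of their vertices on one server leave no room for a block B r there.
    Heavy : Fin (suc ℓ₂) → Set
    Heavy i = ∃ λ s → 7 * p ≤ 4 * at a s (X i)

    B-at : ∀ r → at a (proj₁ (constB r)) (B r) ≡ length (B r)
    B-at r = count-all _ (proj₂ (constB r))

    Unique-load : ∀ {xs} s → Unique xs → at a s xs ≤ k + e
    Unique-load s u = ≤-trans (count-Unique (λ v → a v ≟ s) u) (loads s)

    -- From `8 * p ≤ k` each block has at least `5 * p` vertices, whereas beside a block there is
    -- room for only `3 * p + e`; sharing a server would force `2 * p ≤ e`.
    B-apart : ∀ {r r′} → r ≢ r′ → proj₁ (constB r) ≢ proj₁ (constB r′)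
    B-apart {r} {r′} r≢r′ eq = <⇒≱ (*-monoʳ-< 2 2e<p) (begin
      2 * p                      ≤⟨ +-cancelˡ-≤ (2 * p + p) (2 * p) e (+-cancelˡ-≤ b _ _ (begin
        b + ((2 * p + p) + 2 * p)  ≤⟨ +-monoʳ-≤ b (+-cancelʳ-≤ (2 * p + p) _ _ (begin
          2 * p + p + 2 * p + (2 * p + p) ≡⟨ eight p ⟩
          8 * p                           ≤⟨ 8p≤k ⟩
          k                               ≡⟨ length-B+3p r′ ⟨
          b′ + (2 * p + p)                ∎)) ⟩
        b + b′                     ≡⟨ cong₂ _+_ (B-at r) (trans (cong (λ s → at a s (B r′)) eq) (B-at r′)) ⟨
        at a s (B r) + at a s (B r′) ≡⟨ count-++ _ (B r) (B r′) ⟨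
        at a s (B r ++ B r′)       ≤⟨ Unique-load s (Uniqueₚ.++⁺ (B-unique r) (B-unique r′) (cell-disjoint-server r r′ r≢r′)) ⟩
        k + e                      ≡⟨ cong (_+ e) (length-B+3p r) ⟨
        b + (2 * p + p) + e        ≡⟨ +-assoc b _ e ⟩
        b + (2 * p + p + e)        ∎)) ⟩
      e                          ≤⟨ m≤n*m e 4 ⟩
      4 * e                      ≡⟨ *-assoc 2 2 e ⟩
      2 * (2 * e)                ∎)
      where
      open ≤-Reasoning
      s = proj₁ (constB r)
      b = length (B r)
      b′ = length (B r′)
      eight : ∀ p → 2 * p + p + 2 * p + (2 * p + p) ≡ 8 * p
      eight = solve-∀

    -- The two sets bring at least 7p / 2 vertices to the server, but a block leaves room for
    -- `3 * p + e`, where e < p / 2.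
    crowded : ∀ {i j r} → i ≢ j → (hi : Heavy i) (hj : Heavy j) → proj₁ hi ≡ proj₁ hj → proj₁ (constB r) ≢ proj₁ hi
    crowded {i} {j} {r} i≢j (s , hi) (_ , hj) refl eq = <⇒≱ (*-monoʳ-< 2 2e<p) (begin
      2 * p                ≤⟨ +-cancelˡ-≤ (4 * b + 12 * p) (2 * p) (4 * e) (begin
        4 * b + 12 * p + 2 * p       ≡⟨ fourteen b p ⟩
        4 * b + (7 * p + 7 * p)      ≤⟨ +-monoʳ-≤ (4 * b) (+-mono-≤ hi hj) ⟩
        4 * b + (4 * x + 4 * y)      ≡⟨ four b x y ⟩
        4 * (b + (x + y))            ≤⟨ *-monoʳ-≤ 4 load≤ ⟩
        4 * (b + (2 * p + p) + e)    ≡⟨ twelve b p e ⟩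
        4 * b + 12 * p + 4 * e       ∎) ⟩
      4 * e                ≡⟨ *-assoc 2 2 e ⟩
      2 * (2 * e)          ∎)
      where
      open ≤-Reasoning
      b = length (B r)
      x = at a s (X i)
      y = at a s (X j)
      fourteen : ∀ b p → 4 * b + 12 * p + 2 * p ≡ 4 * b + (7 * p + 7 * p)
      fourteen = solve-∀
      four : ∀ b x y → 4 * b + (4 * x + 4 * y) ≡ 4 * (b + (x + y))
      four = solve-∀
      twelve : ∀ b p e → 4 * (b + (2 * p + p) + e) ≡ 4 * b + 12 * p + 4 * e
      twelve = solve-∀
      B#XX : Disjoint (B r) (X i ++ X j)
      B#XX (v∈B , v∈XX) with ∈-++⁻ (X i) v∈XX
      ... | inj₁ v∈Xi = X#B i r (v∈Xi , v∈B)
      ... | inj₂ v∈Xj = X#B j r (v∈Xj , v∈B)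
      load≤ : b + (x + y) ≤ b + (2 * p + p) + e
      load≤ = begin
        b + (x + y)                          ≡⟨ cong₂ _+_ (trans (cong (λ s → at a s (B r)) (sym eq)) (B-at r)) (count-++ _ (X i) (X j)) ⟨
        at a s (B r) + at a s (X i ++ X j)   ≡⟨ count-++ _ (B r) (X i ++ X j) ⟨
        at a s (B r ++ X i ++ X j)           ≤⟨ Unique-load s (Uniqueₚ.++⁺ (B-unique r) (Uniqueₚ.++⁺ (X-unique i) (X-unique j) (X-disjoint i j i≢j)) B#XX) ⟩
        k + e                                ≡⟨ cong (_+ e) (length-B+3p r) ⟨
        b + (2 * p + p) + e                  ∎

    -- The pigeonhole principle is used twice. It first yields two heavy sets on a common server.
    -- This server and the servers of the blocks are again one more than the number of servers, so
    -- two blocks share a server or some block meets the two sets.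
    ¬all-heavy : ¬ (∀ i → Heavy i)
    ¬all-heavy heavy =
      let i , j , i<j , same = pigeonhole ≤-refl (proj₁ ∘ heavy)
      in clash (Fin.<⇒≢ i<j) same (pigeonhole ≤-refl (positions i))
      where
      positions : Fin (suc ℓ₂) → Fin (suc ℓ₂) → Fin ℓ₂
      positions i zero    = proj₁ (heavy i)
      positions i (suc r) = proj₁ (constB r)
      clash : ∀ {i j} → i ≢ j → proj₁ (heavy i) ≡ proj₁ (heavy j) →
        (∃₂ λ x y → x Data.Fin.< y × positions i x ≡ positions i y) → ⊥
      clash {i} {j} i≢j same (zero , suc r , _ , eq) = crowded {i} {j} {r} i≢j (heavy i) (heavy j) same (sym eq)
      clash i≢j same (suc r , suc r′ , s≤s r<r′ , eq) = B-apart (Fin.<⇒≢ r<r′) eq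

    spread-exists : ∃ λ i → Spread a (X i)
    spread-exists =
      let i , ¬heavy = ¬∀⟶∃¬ (suc ℓ₂) Heavy (λ i → any? (λ s → 7 * p ≤? 4 * at a s (X i))) ¬all-heavy
      in i , λ s → ≰⇒> (λ h → ¬heavy (s , h))

  -- The adversary and the online cost

  module Game (m e : ℕ) (p≡2^m : p ≡ 2 ^ m) (0<m : 0 < m) (2e<p : 2 * e < p) (8p≤k : 8 * p ≤ k)
              (alg : OnlineAlg ℓ₂ k) (online : IsOnlineAlg ℓ₂ k (k + e) alg) where

    cost : List (List V) → ℕ
    cost Q = onlCost {ℓ₂} {k} alg a₀ (glue Q)

    reply : List (List V) → Assignment ℓ₂ k
    reply Q = current {ℓ₂} {k} alg a₀ (glue Q)

    reply-admissible : ∀ {Q} → 0 < length (glue Q) → CheapSolution Q →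
      All (Const (reply Q)) Q × LoadBounded {ℓ₂} {k} (k + e) (reply Q)
    reply-admissible {Q} nonempty cheap =
      let cc , loads = current-admissible {ℓ₂} {k} alg a₀ online a₀-balanced (glue Q) nonempty (CheapSolution⇒ValidSeq {Q} cheap)
      in Respects-glue⇒Const (reply Q) Q (CC⇒Respects {ℓ₂} {k} cc) , loads

    cost-++ : (Q N : List (List V)) → cost Q + dist {ℓ₂} {k} (reply Q) (reply (Q ++ N)) ≤ cost (Q ++ N)
    cost-++ Q N = subst (λ E → cost Q + dist {ℓ₂} {k} (reply Q) (current {ℓ₂} {k} alg a₀ E) ≤ onlCost {ℓ₂} {k} alg a₀ E)
      (sym (concatMap-++ star Q N)) (onlCost-++ {ℓ₂} {k} alg a₀ (glue Q) (glue N))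

    nonempty-++ : (Q N : List (List V)) → 0 < length (glue Q) → 0 < length (glue (Q ++ N))
    nonempty-++ Q N nonempty = ≤-trans nonempty (subst (λ E → length (glue Q) ≤ length E)
      (sym (concatMap-++ star Q N)) (length-++-≤ˡ (glue Q)))

    -- By `closed` and `glued` the requests force at least the recorded gluing. By `free` they force
    -- no more within an unfinished set, so any unfinished set can act as the `X t` of the offline
    -- solution.
    record SetState (Q : List (List V)) (i : Fin (suc ℓ₂)) (g : ℕ) (ps : List (List V)) : Set where
      constructor setState
      field
        pieces : Pieces g (X i) ps
        closed : g ≡ 0 → X i ∈ Q
        glued  : ∀ (a : Assignment ℓ₂ k) → All (Const a) Q → All (Const a) ps
        free   : 0 < g → Free i ps Q

    record State (Q : List (List V)) (g : Fin (suc ℓ₂) → ℕ) (ps : Fin (suc ℓ₂) → List (List V)) : Set where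
      constructor state
      field
        sets     : ∀ i → SetState Q i (g i) (ps i)
        gluedB   : ∀ r → B r ∈ Q
        nonempty : 0 < length (glue Q)
        -- every round costs the online algorithm p / 8 and lowers total g by one
        paid     : suc ℓ₂ * m * p ≤ 8 * cost Q + total g * p

    Outcome : Set
    Outcome = Σ (List (List V)) λ Q → CheapSolution Q × suc ℓ₂ * m * p ≤ 8 * cost Q

    module Step {Q g ps} (st : State Q g ps) (constQ : All (Const (reply Q)) Q)
                (i : Fin (suc ℓ₂)) (spread : Spread (reply Q) (X i)) where

      open State st
      open module S i = SetState (sets i)

      a : Assignment ℓ₂ k
      a = reply Q

      -- A finished set is glued completely, so it lies on one server and is not spread out.
      unfinished : g i ≢ 0
      unfinished gi≡0 = let s , all = All.lookup constQ (closed i gi≡0) in <⇒≱ (spread s) (begin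
        7 * p                ≤⟨ *-monoˡ-≤ p (n≤1+n 7) ⟩
        8 * p                ≡⟨ *-assoc 4 2 p ⟩
        4 * (2 * p)          ≡⟨ cong (4 *_) (length-X i) ⟨
        4 * length (X i)     ≡⟨ cong (4 *_) (count-all (λ v → a v ≟ s) all) ⟨
        4 * at a s (X i)     ∎)
        where open ≤-Reasoning

      pieces-i : ∀ {n} → g i ≡ suc n → Pieces (suc n) (X i) (ps i)
      pieces-i gi≡ = subst (λ h → Pieces h (X i) (ps i)) gi≡ (pieces i)

      Merging : Set
      Merging = ∃ λ prs → ps i ↭ flatten prs × (∀ b → All (Const b) (merge prs) → p ≤ 8 * moved a b (X i))

      merging-i : ∀ {n} → g i ≡ suc n → Merging
      merging-i {n} gi≡ = merging a {n} (length-X i) (pieces-i gi≡) (glued i a constQ) spread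

      module Merge {n : ℕ} (gi≡ : g i ≡ suc n) (prs : List (List V × List V)) (perm : ps i ↭ flatten prs)
                   (pay : ∀ b → All (Const b) (merge prs) → p ≤ 8 * moved a b (X i)) where

        N : List (List V)
        N = merge prs

        pieces-N : Pieces n (X i) N
        pieces-N = Pieces-merge {n} prs perm (pieces-i gi≡)

        X⇒N : ∀ (b : Assignment ℓ₂ k) → Const b (X i) → All (Const b) N
        X⇒N b c = All.map {P = _⊆ X i} (λ q⊆X → Const-⊆ b q⊆X c) (Pieces-⊆ {n} pieces-N)

        free-N : Free i N (Q ++ N)
        free-N b cX cB cN = Allₚ.++⁺ (free i (subst (0 <_) (sym gi≡) z<s) b cX cB
          (All-resp-↭ (↭-sym perm) (Const-merge⇒flatten b prs cN))) cN

        -- The reply to the whole batch `N ++ E` keeps the merged pieces together, so it differs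
        -- from `a` on at least p / 8 vertices of `X i`. This pays for lowering the counter by one.
        payment : {g′ : Fin (suc ℓ₂) → ℕ} (E : List (List V)) → CheapSolution (Q ++ N ++ E) → total g ≡ suc (total g′) →
          suc ℓ₂ * m * p ≤ 8 * cost (Q ++ N ++ E) + total g′ * p
        payment {g′} E cheap total≡ = begin
          suc ℓ₂ * m * p                      ≤⟨ paid ⟩
          8 * cost Q + total g * p            ≡⟨ cong (λ x → 8 * cost Q + x * p) total≡ ⟩
          8 * cost Q + (p + total g′ * p)     ≡⟨ +-assoc (8 * cost Q) p _ ⟨
          8 * cost Q + p + total g′ * p       ≤⟨ +-monoˡ-≤ (total g′ * p) (begin
            8 * cost Q + p                      ≤⟨ +-monoʳ-≤ (8 * cost Q) (pay b constN) ⟩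
            8 * cost Q + 8 * moved a b (X i)    ≤⟨ +-monoʳ-≤ (8 * cost Q) (*-monoʳ-≤ 8 (count-Unique (λ v → ¬? (a v ≟ b v)) (X-unique i))) ⟩
            8 * cost Q + 8 * dist {ℓ₂} {k} a b  ≡⟨ *-distribˡ-+ 8 (cost Q) _ ⟨
            8 * (cost Q + dist {ℓ₂} {k} a b)    ≤⟨ *-monoʳ-≤ 8 (cost-++ Q (N ++ E)) ⟩
            8 * cost (Q ++ N ++ E)              ∎) ⟩
          8 * cost (Q ++ N ++ E) + total g′ * p ∎
          where
          open ≤-Reasoning
          b = reply (Q ++ N ++ E)
          constN : All (Const b) N
          constN = Allₚ.++⁻ˡ N (Allₚ.++⁻ʳ Q (proj₁ (reply-admissible {Q ++ N ++ E} (nonempty-++ Q (N ++ E) nonempty) cheap)))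

        g⁺ : Fin (suc ℓ₂) → ℕ
        g⁺ = updateAt g i (λ _ → n)

        ps⁺ : Fin (suc ℓ₂) → List (List V)
        ps⁺ = updateAt ps i (λ _ → N)

        g⁺-other : ∀ j → j ≢ i → g⁺ j ≡ g j
        g⁺-other j j≢i = updateAt-minimal j i g j≢i

        total-g⁺ : total g ≡ suc (total g⁺)
        total-g⁺ = total-decrease i (trans gi≡ (cong suc (sym (updateAt-updates i g)))) g⁺-other

        -- The last unfinished set stays in its two halves, because the offline solution needs one
        -- set that is not glued. The counter was 1 and is now 0, so the whole amount has been paid.
        finish : n ≡ 0 → (∀ j → j ≢ i → g j ≡ 0) → Outcome
        finish refl others = Q ++ N ++ [] , cheap
          , subst (λ x → suc ℓ₂ * m * p ≤ x) (trans (cong (λ x → 8 * cost (Q ++ N ++ []) + x * p) total0) (+-identityʳ _))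
              (payment {λ _ → 0} [] cheap (total-decrease i gi≡ (λ j j≢i → sym (others j j≢i))))
          where
          total0 : total {suc ℓ₂} (λ _ → 0) ≡ 0
          total0 = trans (total-const (suc ℓ₂) 0) (*-zeroʳ (suc ℓ₂))
          cheap : CheapSolution (Q ++ N ++ [])
          cheap = subst (λ R → CheapSolution (Q ++ R)) (sym (++-identityʳ N)) (cheap-solution i {0} pieces-N free-N)

        -- E is [] while X i can still be merged further, and [ X i ] in its last round.
        module _ (E : List (List V)) (E-X : ∀ (b : Assignment ℓ₂ k) → Const b (X i) → All (Const b) E)
                 (E-closed : n ≡ 0 → X i ∈ E) (E-free : 0 < n → E ≡ []) where

          sets⁺ : ∀ j → SetState (Q ++ N ++ E) j (g⁺ j) (ps⁺ j)
          sets⁺ j with j ≟ i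
          -- The new requests only glue vertices of `X i`, and `Free j` may assume that `X i` stays
          -- together.
          ... | no j≢i = subst₂ (SetState (Q ++ N ++ E) j) (sym (g⁺-other j j≢i)) (sym (updateAt-minimal j i ps j≢i)) (setState
            (pieces j)
            (λ gj≡0 → ∈-++⁺ˡ (closed j gj≡0))
            (λ b c → glued j b (Allₚ.++⁻ˡ Q c))
            (λ 0<gj b cX cB cps → Allₚ.++⁺ (free j 0<gj b cX cB cps)
              (Allₚ.++⁺ (X⇒N b (cX i (j≢i ∘ sym))) (E-X b (cX i (j≢i ∘ sym))))))
          ... | yes refl = subst₂ (SetState (Q ++ N ++ E) j) (sym (updateAt-updates i g)) (sym (updateAt-updates i ps)) (setState
            pieces-N
            (λ n≡0 → ∈-++⁺ʳ Q (∈-++⁺ʳ N (E-closed n≡0)))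
            (λ b c → Allₚ.++⁻ˡ N (Allₚ.++⁻ʳ Q c))
            (λ 0<n → subst (λ R → Free i N (Q ++ R)) (sym (trans (cong (N ++_) (E-free 0<n)) (++-identityʳ N))) free-N))

          -- A set `t⁺` that remains unfinished witnesses that the extended request sequence is
          -- still valid, so the algorithm must answer it.
          advance : (t⁺ : Fin (suc ℓ₂)) → 0 < g⁺ t⁺ → State (Q ++ N ++ E) g⁺ ps⁺
          advance t⁺ 0<gt⁺ = state sets⁺ (λ r → ∈-++⁺ˡ (gluedB r)) (nonempty-++ Q (N ++ E) nonempty)
            (payment {g⁺} E (cheap-solution t⁺ {g⁺ t⁺} (SetState.pieces (sets⁺ t⁺)) (SetState.free (sets⁺ t⁺) 0<gt⁺)) total-g⁺)

    spread-set : ∀ {Q g ps} → State Q g ps → (t : Fin (suc ℓ₂)) → 0 < g t →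
      All (Const (reply Q)) Q × ∃ λ i → Spread (reply Q) (X i)
    spread-set {Q} {g} (state sets gluedB nonempty _) t 0<gt =
      let constQ , loads = reply-admissible {Q} nonempty
            (cheap-solution t {g t} (SetState.pieces (sets t)) (SetState.free (sets t) 0<gt))
      in constQ , spread-exists e 2e<p 8p≤k (reply Q) loads (λ r → All.lookup constQ (gluedB r))

    Next : (g : Fin (suc ℓ₂) → ℕ) → Set
    Next g = ∃ λ Q → ∃₂ λ g′ ps → total g ≡ suc (total g′) × State Q g′ ps × ∃ λ t → 0 < g′ t

    round : ∀ {Q g ps} → State Q g ps → All (Const (reply Q)) Q → (i : Fin (suc ℓ₂)) →
      Spread (reply Q) (X i) → Outcome ⊎ Next g
    round {Q} {g} {ps} st constQ i spread = move (g i) refl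
      where
      open Step st constQ i spread
      merge-only : ∀ {n} → g i ≡ suc (suc n) → Merging → Next g
      -- After this merge `X i` still has more than two pieces, so it can itself serve as the
      -- unfinished set.
      merge-only gi≡ (prs , perm , pay) =
        _ , g⁺ , ps⁺ , total-g⁺ , advance [] (λ _ _ → []) (λ ()) (λ _ → refl) i 0<g⁺ , i , 0<g⁺
        where
        open Merge gi≡ prs perm pay
        0<g⁺ : 0 < g⁺ i
        0<g⁺ = subst (0 <_) (sym (updateAt-updates i g)) z<s
      merge-and-close : g i ≡ 1 → Merging → ∀ j → j ≢ i → 0 < g j → Next g
      merge-and-close gi≡ (prs , perm , pay) j j≢i 0<gj =
        _ , g⁺ , ps⁺ , total-g⁺ , advance [ X i ] (λ _ c → c ∷ []) (λ _ → here refl) (λ ()) j 0<g⁺ , j , 0<g⁺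
        where
        open Merge gi≡ prs perm pay
        0<g⁺ : 0 < g⁺ j
        0<g⁺ = subst (0 <_) (sym (g⁺-other j j≢i)) 0<gj
      stop : g i ≡ 1 → Merging → (∀ j → j ≢ i → g j ≡ 0) → Outcome
      stop gi≡ (prs , perm , pay) = Merge.finish gi≡ prs perm pay refl
      move : ∀ h → g i ≡ h → Outcome ⊎ Next g
      move zero gi≡ = contradiction gi≡ unfinished
      move (suc (suc n)) gi≡ = inj₂ (merge-only gi≡ (merging-i gi≡))
      -- This merge leaves two pieces of `X i`. They are glued only if another unfinished set
      -- remains for the offline solution; otherwise the game ends.
      move (suc zero) gi≡ with any? (λ j → ¬? (j ≟ i) ×-dec (0 <? g j))
      ... | yes (j , j≢i , 0<gj) = inj₂ (merge-and-close gi≡ (merging-i gi≡) j j≢i 0<gj)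
      ... | no none = inj₁ (stop gi≡ (merging-i gi≡)
                             (λ j j≢i → n≤0⇒n≡0 (≮⇒≥ (λ 0<gj → none (j , j≢i , 0<gj)))))

    turn : ∀ {Q g ps} → State Q g ps → (t : Fin (suc ℓ₂)) → 0 < g t → Outcome ⊎ Next g
    turn st t 0<gt = (λ (constQ , i , spread) → round st constQ i spread) (spread-set st t 0<gt)

    play : ∀ fuel {g : Fin (suc ℓ₂) → ℕ} → total g ≡ fuel → Outcome ⊎ Next g → Outcome
    play _       _      (inj₁ outcome) = outcome
    -- Every round lowers the counter by exactly one, so no round can start from zero.
    play zero    total≡ (inj₂ (_ , _ , _ , total≡′ , _)) = contradiction (trans (sym total≡) total≡′) λ ()
    play (suc f) total≡ (inj₂ (_ , g′ , _ , total≡′ , st , t , 0<gt)) =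
      play f {g′} (suc-injective (trans (sym total≡′) total≡)) (turn st t 0<gt)

    -- At first only the blocks are glued. The pieces are single vertices, and `2 * 2 ^ m` of them
    -- allow `m` mergings per set.
    initial : State (tabulate B) (λ _ → m) (λ i → map [_] (X i))
    initial = state sets (λ r → ∈-tabulate⁺ {f = B} r) nonempty paid
      where
      singles : ∀ (b : Assignment ℓ₂ k) xs → All (Const b) (map [_] xs)
      singles b xs = Allₚ.map⁺ (All.tabulate λ {v} _ → b v , refl ∷ [])
      sets : ∀ i → SetState (tabulate B) i m (map [_] (X i))
      sets i = setState
        (trans (length-map [_] (X i)) (trans (length-X i) (cong (2 *_) p≡2^m))
          , (1 , Allₚ.map⁺ (All.tabulate λ _ → refl) , trans (*-identityˡ (2 ^ m)) (sym p≡2^m))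
          , ↭-reflexive concat-map-[ X i ])
        (λ m≡0 → contradiction m≡0 (>⇒≢ 0<m))
        (λ b _ → singles b (X i))
        (λ _ b _ cB _ → Allₚ.tabulate⁺ cB)
      0<p : 0 < p
      0<p = ≤-<-trans z≤n 2e<p
      -- Two vertices in a block guarantee that the opening contains an edge.
      B≥2 : 2 ≤ length (B zero)
      B≥2 = +-cancelʳ-≤ (2 * p + p) 2 _ (begin
        2 + (2 * p + p)                   ≤⟨ +-monoˡ-≤ (2 * p + p) (*-monoʳ-≤ 2 0<p) ⟩
        2 * p + (2 * p + p)               ≤⟨ +-monoʳ-≤ (2 * p) (m≤m+n (2 * p + p) (2 * p + p)) ⟩
        2 * p + (2 * p + p + (2 * p + p)) ≡⟨ eight p ⟩
        8 * p                             ≤⟨ 8p≤k ⟩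
        k                                 ≡⟨ length-B+3p zero ⟨
        length (B zero) + (2 * p + p)     ∎)
        where
        open ≤-Reasoning
        eight : ∀ p → 2 * p + (2 * p + p + (2 * p + p)) ≡ 8 * p
        eight = solve-∀
      star-nonempty : (xs : List V) → 2 ≤ length xs → 0 < length (star xs)
      star-nonempty (x ∷ y ∷ xs) _ = z<s
      star-nonempty (x ∷ []) (s≤s ())
      nonempty : 0 < length (glue (tabulate B))
      nonempty = ≤-trans (star-nonempty (B zero) B≥2) (length-++-≤ˡ (star (B zero)))
      paid : suc ℓ₂ * m * p ≤ 8 * cost (tabulate B) + total {suc ℓ₂} (λ _ → m) * p
      paid = subst (λ x → suc ℓ₂ * m * p ≤ 8 * cost (tabulate B) + x * p) (sym (total-const (suc ℓ₂) m))
        (m≤n+m (suc ℓ₂ * m * p) (8 * cost (tabulate B)))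

    outcome : Outcome
    outcome = play (total {suc ℓ₂} (λ _ → m)) {λ _ → m} refl (turn initial zero 0<m)

-- The offline schedule

module _ {ℓ k : ℕ} (a₀ opt : Assignment ℓ k) where

  -- All moves happen at the first request; an assignment that respects the final graph respects
  -- every earlier one.
  moveOnce : ℕ → Assignment ℓ k
  moveOnce zero    = a₀
  moveOnce (suc _) = opt

  schedCost-moveOnce : ∀ n → schedCost {ℓ} {k} moveOnce n ≤ dist {ℓ} {k} a₀ opt
  schedCost-moveOnce zero          = z≤n
  schedCost-moveOnce (suc zero)    = ≤-refl
  schedCost-moveOnce (suc (suc n)) = begin
    schedCost {ℓ} {k} moveOnce (suc n) + dist {ℓ} {k} opt opt ≡⟨ cong (schedCost {ℓ} {k} moveOnce (suc n) +_) (moved-refl opt (allFin (ℓ * k))) ⟩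
    schedCost {ℓ} {k} moveOnce (suc n) + 0                    ≡⟨ +-identityʳ _ ⟩
    schedCost {ℓ} {k} moveOnce (suc n)                        ≤⟨ schedCost-moveOnce (suc n) ⟩
    dist {ℓ} {k} a₀ opt                                       ∎
    where open ≤-Reasoning

  moveOnce-feasible : {E : List (Edge ℓ k)} → Respects opt E → LoadBounded {ℓ} {k} k opt →
    OfflineFeasible {ℓ} {k} a₀ E moveOnce
  moveOnce-feasible resp loads = refl , λ where
    (suc i) _ _ → Respects⇒CC {ℓ} {k} (Allₚ.take⁺ (suc i) resp) , loads

-- The choice of p and the final ratio

power-bracket : ∀ n → ∃ λ i → 2 ^ i ≤ suc n × suc n < 2 ^ suc i
power-bracket zero = 0 , ≤-refl , ≤-refl
power-bracket (suc n) with i , lower , upper ← power-bracket n with suc (suc n) <? 2 ^ suc i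
... | yes 2+n<  = i , m≤n⇒m≤1+n lower , 2+n<
... | no  2+n≮  = suc i , ≮⇒≥ 2+n≮ , (begin-strict
  suc (suc n)       ≤⟨ upper ⟩
  2 ^ suc i         <⟨ ^-monoʳ-< 2 (s≤s (s≤s z≤n)) (n<1+n (suc i)) ⟩
  2 ^ suc (suc i)   ∎)
  where open ≤-Reasoning

-- If `k` lies between the powers of 2 with exponents i and i + 1, take m = i - 3. From `32 ≤ k`
-- follows i ≥ 5, so m ≥ 2, and the logarithm is at most m + 4 ≤ 3m.
scale : ∀ k → 32 ≤ k → ∃ λ m → 2 ≤ m × 8 * 2 ^ m ≤ k × k < 16 * 2 ^ m × ⌊log₂ k ⌋ ≤ 3 * m
scale (suc n) 32≤k
  with i , lower , upper ← power-bracket n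
  with m , refl ← m≤n⇒∃[o]m+o≡n {5} {i} (≮⇒≥ λ i<5 → <⇒≱ upper (≤-trans (^-monoʳ-≤ 2 i<5) 32≤k))
  = 2 + m , s≤s (s≤s z≤n)
  , subst (_≤ suc n) (^-distribˡ-+-* 2 3 (2 + m)) lower
  , subst (suc n <_) (^-distribˡ-+-* 2 4 (2 + m)) upper
  , (begin
    ⌊log₂ suc n ⌋            ≤⟨ ⌊log₂⌋-mono-≤ (<⇒≤ upper) ⟩
    ⌊log₂ 2 ^ (6 + m) ⌋      ≡⟨ ⌊log₂[2^n]⌋≡n (6 + m) ⟩
    6 + m                    ≤⟨ +-monoʳ-≤ 6 (m≤n*m m 3) ⟩
    6 + 3 * m                ≡⟨ *-distribˡ-+ 3 2 m ⟨
    3 * (2 + m)              ∎)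
  where open ≤-Reasoning

theorem7p1 : Σ ℕ λ C → (1 ≤ C) ×
    ((ℓ k j : ℕ) → 2 ≤ ℓ → 32 ≤ k → 32 * 2 ^ j ≤ k →
    (alg : OnlineAlg ℓ k) → IsOnlineAlg ℓ k (k + 2 ^ j) alg →
    Σ (Assignment ℓ k) λ a₀ → Balanced {ℓ} {k} a₀ ×
    Σ (List (Edge ℓ k)) λ σ → ValidSeq {ℓ} {k} σ ×
    (0 < onlCost alg a₀ σ) ×
    Σ (ℕ → Assignment ℓ k) λ s → OfflineFeasible {ℓ} {k} a₀ σ s ×
    (ℓ * ⌊log₂ k ⌋ * schedCost s (length σ) ≤ C * onlCost alg a₀ σ))
-- 96 is 8 · 3 · 4: a round costs p / 8 online, the logarithm is at most `3 * m`, and the offline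
-- cost is at most `4 * p`.
theorem7p1 = 96 , s≤s z≤n , lower-bound
  where
  lower-bound : (ℓ k j : ℕ) → 2 ≤ ℓ → 32 ≤ k → 32 * 2 ^ j ≤ k →
    (alg : OnlineAlg ℓ k) → IsOnlineAlg ℓ k (k + 2 ^ j) alg →
    Σ (Assignment ℓ k) λ a₀ → Balanced {ℓ} {k} a₀ ×
    Σ (List (Edge ℓ k)) λ σ → ValidSeq {ℓ} {k} σ ×
    (0 < onlCost {ℓ} {k} alg a₀ σ) ×
    Σ (ℕ → Assignment ℓ k) λ s → OfflineFeasible {ℓ} {k} a₀ σ s ×
    (ℓ * ⌊log₂ k ⌋ * schedCost {ℓ} {k} s (length σ) ≤ 96 * onlCost {ℓ} {k} alg a₀ σ)
  lower-bound (suc zero) _ _ (s≤s ())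
  lower-bound (suc (suc ℓ′)) k j _ 32≤k 32e≤k alg online
    with m , 2≤m , 8p≤k , k<16p , log≤ ← scale k 32≤k = conclude outcome
    where
    p e ℓ₂ : ℕ
    p = 2 ^ m
    e = 2 ^ j
    ℓ₂ = suc (suc ℓ′)

    2e<p : 2 * e < p
    2e<p = *-cancelˡ-< 16 _ _ (begin-strict
      16 * (2 * e)   ≡⟨ *-assoc 16 2 e ⟨
      32 * e         ≤⟨ 32e≤k ⟩
      k              <⟨ k<16p ⟩
      16 * p         ∎)
      where open ≤-Reasoning

    3p≤k : 2 * p + p ≤ k
    3p≤k = begin
      2 * p + p      ≡⟨ +-comm (2 * p) p ⟩
      3 * p          ≤⟨ *-monoˡ-≤ p {3} {8} (s≤s (s≤s (s≤s z≤n))) ⟩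
      8 * p          ≤⟨ 8p≤k ⟩
      k              ∎
      where open ≤-Reasoning

    0<m : 0 < m
    0<m = ≤-trans (s≤s z≤n) 2≤m

    open Instance ℓ′ k p 3p≤k using (a₀; a₀-balanced; CheapSolution⇒ValidSeq; module Game)
    open Game m e refl 0<m 2e<p 8p≤k alg online using (Outcome; outcome)

    positive : ∀ c → suc ℓ₂ * m * p ≤ 8 * c → 0 < c
    positive zero    paid = contradiction (≤-trans (*-mono-≤ (*-mono-≤ (s≤s (z≤n {ℓ₂})) 0<m) (m^n>0 2 m)) paid) λ ()
    positive (suc c) _    = z<s

    bound : ∀ c d → suc ℓ₂ * m * p ≤ 8 * c → d ≤ 4 * p → ℓ₂ * ⌊log₂ k ⌋ * d ≤ 96 * c
    bound c d paid d≤ = begin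
      ℓ₂ * ⌊log₂ k ⌋ * d          ≤⟨ *-mono-≤ (*-monoʳ-≤ ℓ₂ log≤) d≤ ⟩
      ℓ₂ * (3 * m) * (4 * p)      ≡⟨ twelve ℓ₂ m p ⟩
      12 * (ℓ₂ * m * p)           ≤⟨ *-monoʳ-≤ 12 (*-monoˡ-≤ p (*-monoˡ-≤ m (n≤1+n ℓ₂))) ⟩
      12 * (suc ℓ₂ * m * p)       ≤⟨ *-monoʳ-≤ 12 paid ⟩
      12 * (8 * c)               ≡⟨ *-assoc 12 8 c ⟨
      96 * c                     ∎
      where
      open ≤-Reasoning
      twelve : ∀ x m p → x * (3 * m) * (4 * p) ≡ 12 * (x * m * p)
      twelve = solve-∀

    conclude : Outcome → _
    conclude (Q , cheap@(opt , loads , resp , near) , paid) =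
      a₀ , a₀-balanced , glue Q , CheapSolution⇒ValidSeq {Q} cheap , positive cost paid
      , moveOnce {ℓ₂} {k} a₀ opt , moveOnce-feasible {ℓ₂} {k} a₀ opt resp loads
      , bound cost _ paid (≤-trans (schedCost-moveOnce {ℓ₂} {k} a₀ opt (length (glue Q))) near)
      where cost = onlCost {ℓ₂} {k} alg a₀ (glue Q)
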